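{- For any integers $k,n\geq 1$ and $m>2$, there exists a cyclic $(C_{4k}\times P_m)$-decomposition of each of the following complete multipartite graphs: $K_{(4k+1)\times 2(2m-1)n}$, $K_{(2k+1)\times 4(2m-1)n}$, and $K_{(k+1)\times 8(2m-1)n}$.
   Context: $C_r$ ($r\ge 3$) is the cycle on $r$ vertices and $P_m$ ($m\ge 2$) is the path on $m$ vertices. $C_r\times P_m$ denotes their Cartesian product (the grid on a cylinder): its vertices are the pairs $(i,j)$ with $1\le i\le m$, $1\le j\le r$, and its edges are $[(i,j),(i,j+1)]$ (with $j$ taken modulo $r$) for $1\le i\le m$, and $[(i,j),(i+1,j)]$ for $1\le i\le m-1$. $K_{s\times t}$ denotes the complete $s$-partite graph with all parts of size $t$. Given a subgraph $\Gamma$ of a graph $K$, a $\Gamma$-decomposition of $K$ is a set of subgraphs of $K$ (called blocks), each isomorphic to $\Gamma$, whose edge-sets partition the edge-set of $K$. Such a decomposition is cyclic if it is invariant under a cyclic permutation of all vertices of $K$, i.e. there is a permutation of $V(K)$ consisting of a single cycle of length $|V(K)|$ which maps the set of blocks onto itself. -}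

module Defs where

open import Data.Bool.Base using (Bool; T)
open import Data.Fin.Base using (Fin; toℕ)
open import Data.Fin.Properties using (toℕ<n; toℕ-fromℕ<)
open import Data.Nat.Base using (ℕ; suc; _*_; _≤_; _%_; s≤s)
open import Data.Nat.DivMod using (_mod_; m%n<n; n%n≡0; m<n⇒m%n≡m)
open import Data.Nat.Properties using (1+n≢n; m≤n⇒m<n∨m≡n; suc-injective; *-monoʳ-≤; ≤-trans; n≤1+n)
open import Data.Product using (Σ; ∃-syntax; _×_; _,_; proj₁; proj₂)
open import Data.Sum using (_⊎_; inj₁; inj₂; swap)
open import Function.Base using (_∘_)
open import Function.Bundles using (_↔_; _⇔_; Inverse)
open import Level using (0ℓ)
open import Relation.Binary.PropositionalEquality using (_≡_; _≢_; refl; sym; trans; cong)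
open import Relation.Nullary using (¬_)
open import Relation.Unary using (Pred; _∈_)

record Graph : Set₁ where
  field
    V      : Set
    Adj    : V → V → Set
    symm   : ∀ {u v} → Adj u v → Adj v u
    irrefl : ∀ {v} → ¬ Adj v v

open Graph public

record _≅_ (G H : Graph) : Set where
  field
    bijection : V G ↔ V H
    adj⇔adj   : ∀ x y → Adj G x y ⇔ Adj H (Inverse.to bijection x) (Inverse.to bijection y)

-- i ↦ i + 1 modulo n.
next : ∀ {n} → Fin n → Fin n
next {suc n} i = suc (toℕ i) mod suc n

toℕ-next : ∀ {n} (i : Fin (suc n)) → toℕ (next i) ≡ suc (toℕ i) % suc n
toℕ-next {n} i = toℕ-fromℕ< (m%n<n (suc (toℕ i)) (suc n))

next≢ : ∀ {n} → 2 ≤ n → (i : Fin n) → next i ≢ i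
next≢ {suc n} 2≤n i eq with trans (sym (toℕ-next i)) (cong toℕ eq) | m≤n⇒m<n∨m≡n (toℕ<n i)
... | %≡i | inj₁ lt = 1+n≢n (trans (sym (m<n⇒m%n≡m lt)) %≡i)
... | %≡i | inj₂ e = absurd 2≤n (trans (sym (suc-injective e)) (trans (sym %≡i) %≡0))
  where
  %≡0 : suc (toℕ i) % suc n ≡ 0
  %≡0 = trans (cong (_% suc n) e) (n%n≡0 (suc n))
  absurd : ∀ {j} → 2 ≤ suc j → ¬ j ≡ 0
  absurd (s≤s ()) refl

cycle : (r : ℕ) → 3 ≤ r → Graph
cycle r 3≤r = record
  { V      = Fin r
  ; Adj    = λ i j → next i ≡ j ⊎ next j ≡ i
  ; symm   = swap
  ; irrefl = λ { {i} (inj₁ e) → next≢ 2≤r i e ; {i} (inj₂ e) → next≢ 2≤r i e }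
  }
  where
  2≤r : 2 ≤ r
  2≤r = ≤-trans (n≤1+n 2) 3≤r

path : ℕ → Graph
path m = record
  { V      = Fin m
  ; Adj    = λ i j → suc (toℕ i) ≡ toℕ j ⊎ suc (toℕ j) ≡ toℕ i
  ; symm   = swap
  ; irrefl = λ { (inj₁ e) → 1+n≢n e ; (inj₂ e) → 1+n≢n e }
  }

infixr 7 _□_

_□_ : Graph → Graph → Graph
G □ H = record
  { V      = V G × V H
  ; Adj    = λ (x , y) (x′ , y′) → (Adj G x x′ × y ≡ y′) ⊎ (x ≡ x′ × Adj H y y′)
  ; symm   = λ { (inj₁ (a , e)) → inj₁ (symm G a , sym e)
               ; (inj₂ (e , a)) → inj₂ (sym e , symm H a) }
  ; irrefl = λ { (inj₁ (a , _)) → irrefl G a ; (inj₂ (_ , a)) → irrefl H a }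
  }

-- K s t is the complete s-partite graph with parts of size t; the first
-- coordinate of a vertex names its part.
K : ℕ → ℕ → Graph
K s t = record
  { V      = Fin s × Fin t
  ; Adj    = λ u v → proj₁ u ≢ proj₁ v
  ; symm   = λ u≢v → u≢v ∘ sym
  ; irrefl = λ v≢v → v≢v refl
  }

-- The vertex and edge sets are Bool-valued so that membership is a
-- proposition; on a finite vertex set these are all the (classical) subsets.
record Subgraph (G : Graph) : Set where
  field
    vert      : V G → Bool
    edge      : V G → V G → Bool
    edge-sym  : ∀ {u v} → T (edge u v) → T (edge v u)
    edge-vert : ∀ {u v} → T (edge u v) → T (vert u)
    edge-adj  : ∀ {u v} → T (edge u v) → Adj G u v

open Subgraph public

asGraph : ∀ {G} → Subgraph G → Graph
asGraph {G} H = record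
  { V      = ∃[ v ] T (vert H v)
  ; Adj    = λ u v → T (edge H (proj₁ u) (proj₁ v))
  ; symm   = edge-sym H
  ; irrefl = λ e → irrefl G (edge-adj H e)
  }

-- Equality of subgraphs: the same vertex set and the same edge set.
_≈_ : ∀ {G} → Subgraph G → Subgraph G → Set
H ≈ H′ = (∀ v → vert H v ≡ vert H′ v) × (∀ u v → edge H u v ≡ edge H′ u v)

-- Sets of subgraphs are predicates closed under ≈. The edge sets of blocks
-- consist of edges of G by edge-adj, so `covers` and `disjoint` say that they
-- partition the edge set of G.
record IsDecomposition (Γ G : Graph) (𝓑 : Pred (Subgraph G) 0ℓ) : Set where
  field
    resp-≈   : ∀ {B B′} → B ≈ B′ → B ∈ 𝓑 → B′ ∈ 𝓑
    iso      : ∀ {B} → B ∈ 𝓑 → asGraph B ≅ Γ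
    covers   : ∀ {u v} → Adj G u v → ∃[ B ] (B ∈ 𝓑 × T (edge B u v))
    disjoint : ∀ {B B′ u v} → B ∈ 𝓑 → B′ ∈ 𝓑 →
               T (edge B u v) → T (edge B′ u v) → B ≈ B′

-- σ is the N-cycle (c 0, c 1, …, c (N-1)), where c lists every element of A
-- exactly once, so that N = |A|.
IsFullCycle : ∀ {A : Set} → A ↔ A → Set
IsFullCycle {A} σ =
  ∃[ N ] Σ (Fin N ↔ A) λ c → ∀ i → Inverse.to σ (Inverse.to c i) ≡ Inverse.to c (next i)

-- H′ is the image of H under σ. It is a relation rather than a function because
-- σ is not assumed to be an automorphism of G.
Maps : ∀ {G} → V G ↔ V G → Subgraph G → Subgraph G → Set
Maps σ H H′ =
  (∀ v → vert H′ (Inverse.to σ v) ≡ vert H v) ×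
  (∀ u v → edge H′ (Inverse.to σ u) (Inverse.to σ v) ≡ edge H u v)

-- σ maps 𝓑 into itself and onto itself.
Invariant : ∀ {G} → V G ↔ V G → Pred (Subgraph G) 0ℓ → Set
Invariant σ 𝓑 =
  (∀ {B} → B ∈ 𝓑 → ∃[ B′ ] (B′ ∈ 𝓑 × Maps σ B B′)) ×
  (∀ {B′} → B′ ∈ 𝓑 → ∃[ B ] (B ∈ 𝓑 × Maps σ B B′))

IsCyclic : ∀ {G} → Pred (Subgraph G) 0ℓ → Set
IsCyclic {G} 𝓑 = Σ (V G ↔ V G) λ σ → IsFullCycle σ × Invariant σ 𝓑

HasCyclicDecomposition : Graph → Graph → Set₁
HasCyclicDecomposition Γ G =
  Σ (Pred (Subgraph G) 0ℓ) λ 𝓑 → IsDecomposition Γ G 𝓑 × IsCyclic 𝓑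

3≤4*k : ∀ {k} → 1 ≤ k → 3 ≤ 4 * k
3≤4*k 1≤k = ≤-trans (n≤1+n 3) (*-monoʳ-≤ 4 1≤k)

{-# OPTIONS --safe #-}

-- Label the two sides of a bipartite graph Γ by nonnegative and by negative integers,
-- writing a negative label as -1 - a with "height" a. If, over n such labellings, the
-- numbers 1 + (sum of the heights) on the edges run exactly once through the
-- 0 < z < H with s ∤ z, where s ∣ H, then the translates of the labelled copies of Γ in ℤ/2H
-- decompose the Cayley graph of ℤ/2H with connection set the non-multiples of s. This
-- graph is the complete s-partite graph whose parts are the residue classes mod s.
--
-- For the cylinder, shear the layers so that the vertex (j , i) sits over x = j + i in
-- the cycle. Every edge then lies over an edge (x , x + 1) of the cycle and joins levels
-- i and i, or i and i + 1. Adding i * S to the height of layer i makes the 2m - 1 edges over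
-- each edge of the cycle realise consecutive shifts by S, so the problem is reduced to
-- one cycle C_4k, with S = c * s and s = 4k/c + 1, c = 1, 2 or 4. That cycle is labelled by
-- a zigzag in its first half, and in its second half by a translate of the same zigzag
-- shifted by one place, so that the wrap-around edge gets the missing sum.

module Submission where

open import Data.Bool.Base using (Bool; T)
open import Data.Bool.Properties using (T-irrelevant)
open import Data.Fin.Base as Fin using (Fin; toℕ; fromℕ<; combine; remQuot)
open import Data.Fin.Properties as Fin using (toℕ<n; toℕ-injective; toℕ-fromℕ<; toℕ-combine)
open import Data.Nat.Base
open import Data.Nat.DivMod
open import Data.Nat.Divisibility
open import Data.Nat.Properties
open import Data.Nat.Tactic.RingSolver using (solve-∀)
open import Data.Parity.Base as ℙ using (Parity; 0ℙ; 1ℙ; _⁻¹)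
open import Data.Parity.Properties using (⁻¹-involutive; suc-homo-⁻¹; p≢p⁻¹; +-homo-+)
open import Data.Product using (∃; ∃-syntax; _×_; _,_; proj₁; proj₂)
open import Data.Product.Algebra using (×-comm)
open import Data.Product.Properties using (≡-dec)
open import Data.Sum using (_⊎_; inj₁; inj₂)
open import Function.Base using (_∘_)
open import Function.Bundles using (_↔_; _⇔_; mk↔ₛ′; mk⇔; Inverse; Injection; Equivalence)
open import Function.Construct.Composition using (_↔-∘_)
open import Function.Construct.Symmetry using (↔-sym)
open import Function.Properties.Inverse using (Inverse⇒Injection)
open import Level using (0ℓ)
import Relation.Binary.Definitions as B
open import Relation.Binary.Definitions using (Tri; tri<; tri≈; tri>; DecidableEquality)
open import Relation.Binary.PropositionalEquality
open import Relation.Nullary using (¬_; Dec; yes; no; contradiction)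
open import Relation.Nullary.Decidable
  using (isYes; toWitness; fromWitness; _×-dec_; _⊎-dec_; map′)
open import Relation.Unary using (Pred; _∈_; Decidable)
open import Defs

-- Arithmetic modulo d

module Congruence (d : ℕ) .{{_ : NonZero d}} where

  infix 4 _∼_

  -- A record rather than a bare equation of remainders, so that `a` and `b` can be inferred from
  -- the type `a ∼ b`.
  record _∼_ (a b : ℕ) : Set where
    constructor mod≡
    field
      %≡% : a % d ≡ b % d

  open _∼_ public

  ∼-refl : ∀ {a} → a ∼ a
  ∼-refl = mod≡ refl

  ∼-reflexive : ∀ {a b} → a ≡ b → a ∼ b
  ∼-reflexive refl = ∼-refl

  ∼-sym : ∀ {a b} → a ∼ b → b ∼ a
  ∼-sym (mod≡ p) = mod≡ (sym p)

  ∼-trans : ∀ {a b c} → a ∼ b → b ∼ c → a ∼ c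
  ∼-trans (mod≡ p) (mod≡ q) = mod≡ (trans p q)

  infixr 4 _∙_
  _∙_ : ∀ {a b c} → a ∼ b → b ∼ c → a ∼ c
  _∙_ = ∼-trans

  %∼ : ∀ a → a % d ∼ a
  %∼ a = mod≡ (m%n%n≡m%n a d)

  +d∼ : ∀ a → a + d ∼ a
  +d∼ a = mod≡ ([m+n]%n≡m%n a d)

  +-cong-∼ : ∀ {a a′ b b′} → a ∼ a′ → b ∼ b′ → a + b ∼ a′ + b′
  +-cong-∼ {a} {a′} {b} {b′} (mod≡ p) (mod≡ q) = mod≡ (begin
    (a + b) % d            ≡⟨ %-distribˡ-+ a b d ⟩
    (a % d + b % d) % d    ≡⟨ cong₂ (λ u v → (u + v) % d) p q ⟩
    (a′ % d + b′ % d) % d  ≡⟨ %-distribˡ-+ a′ b′ d ⟨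
    (a′ + b′) % d          ∎)
    where open ≡-Reasoning

  -- `h * pred d` serves as `-h`: added to `h + c` it gives `c + h * d`, so cancelling needs no
  -- subtraction.
  +-cancelˡ-∼ : ∀ h {a b} → h + a ∼ h + b → a ∼ b
  +-cancelˡ-∼ h {a} {b} p =
    ∼-sym (complement a) ∙ +-cong-∼ (∼-refl {h * pred d}) p ∙ complement b
    where
    rearrange : ∀ h e c → h * e + (h + c) ≡ c + h * suc e
    rearrange = solve-∀
    complement : ∀ c → h * pred d + (h + c) ∼ c
    complement c =
      ∼-reflexive (trans (rearrange h (pred d) c) (cong (λ e → c + h * e) (suc-pred d)))
      ∙ mod≡ ([m+kn]%n≡m%n c h d)

  ∼⇒≡ : ∀ {a b} → a < d → b < d → a ∼ b → a ≡ b
  ∼⇒≡ a<d b<d (mod≡ p) = trans (sym (m<n⇒m%n≡m a<d)) (trans p (m<n⇒m%n≡m b<d))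

toℕ-mod : ∀ a n .{{_ : NonZero n}} → toℕ (a mod n) ≡ a % n
toℕ-mod a n = toℕ-fromℕ< (m%n<n a n)

toℕ-next-% : ∀ {n} .{{_ : NonZero n}} (i : Fin n) → toℕ (next i) ≡ suc (toℕ i) % n
toℕ-next-% {suc n} i = toℕ-next i

prev : ∀ {n} → Fin n → Fin n
prev {suc n} i = (toℕ i + n) mod suc n

next-prev : ∀ {n} (i : Fin n) → next (prev i) ≡ i
next-prev {suc n} i = toℕ-injective (∼⇒≡ (toℕ<n _) (toℕ<n i)
  (∼-reflexive (toℕ-next (prev i)) ∙ %∼ _
   ∙ +-cong-∼ (∼-refl {1}) (∼-reflexive (toℕ-mod (toℕ i + n) (suc n)) ∙ %∼ _)
   ∙ ∼-reflexive (sym (+-suc (toℕ i) n)) ∙ +d∼ (toℕ i)))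
  where open Congruence (suc n)

prev-next : ∀ {n} (i : Fin n) → prev (next i) ≡ i
prev-next {suc n} i = toℕ-injective (∼⇒≡ (toℕ<n _) (toℕ<n i)
  (∼-reflexive (toℕ-mod (toℕ (next i) + n) (suc n)) ∙ %∼ _
   ∙ +-cong-∼ (∼-reflexive (toℕ-next i) ∙ %∼ _) (∼-refl {n})
   ∙ ∼-reflexive (sym (+-suc (toℕ i) n)) ∙ +d∼ (toℕ i)))
  where open Congruence (suc n)

next-injective : ∀ {n} {i j : Fin n} → next i ≡ next j → i ≡ j
next-injective {i = i} {j} p = trans (sym (prev-next i)) (trans (cong prev p) (prev-next j))

next↔ : ∀ {n} → Fin n ↔ Fin n
next↔ = mk↔ₛ′ next prev next-prev prev-next

-- Subgraphs as images

-- Deciding existence over `V Γ` is what turns the image of a map into the `Bool`-valued vertex and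
-- edge sets of a `Subgraph`.
Searchable : Set → Set₁
Searchable A = ∀ {P : Pred A 0ℓ} → Decidable P → Dec (∃ P)

×-searchable : ∀ {A B} → Searchable A → Searchable B → Searchable (A × B)
×-searchable search search′ P? =
  map′ (λ (a , b , p) → (a , b) , p) (λ ((a , b) , p) → a , b , p)
       (search λ a → search′ λ b → P? (a , b))

isYes-⇔ : ∀ {A B : Set} (a? : Dec A) (b? : Dec B) → (A → B) → (B → A) → isYes a? ≡ isYes b?
isYes-⇔ (yes a) (yes b) f g = refl
isYes-⇔ (yes a) (no ¬b) f g = contradiction (f a) ¬b
isYes-⇔ (no ¬a) (yes b) f g = contradiction (g b) ¬a
isYes-⇔ (no ¬a) (no ¬b) f g = refl

module Image {Γ G : Graph} (search : Searchable (V Γ)) (adj? : B.Decidable (Adj Γ))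
             (_≟_ : DecidableEquality (V G)) where

  IsVertex : (V Γ → V G) → V G → Set
  IsVertex φ v = ∃[ x ] φ x ≡ v

  IsEdge : (V Γ → V G) → V G → V G → Set
  IsEdge φ u v = ∃[ x ] ∃[ y ] (Adj Γ x y × φ x ≡ u × φ y ≡ v)

  isVertex? : ∀ φ v → Dec (IsVertex φ v)
  isVertex? φ v = search λ x → φ x ≟ v

  isEdge? : ∀ φ u v → Dec (IsEdge φ u v)
  isEdge? φ u v = search λ x → search λ y → adj? x y ×-dec (φ x ≟ u ×-dec φ y ≟ v)

  Homomorphism : (V Γ → V G) → Set
  Homomorphism φ = ∀ {x y} → Adj Γ x y → Adj G (φ x) (φ y)

  image : (φ : V Γ → V G) → Homomorphism φ → Subgraph G
  image φ hom = record
    { vert      = λ v → isYes (isVertex? φ v)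
    ; edge      = λ u v → isYes (isEdge? φ u v)
    ; edge-sym  = λ {u} {v} e → let x , y , xy , p , q = toWitness {a? = isEdge? φ u v} e in
                    fromWitness {a? = isEdge? φ v u} (y , x , symm Γ xy , q , p)
    ; edge-vert = λ {u} {v} e → let x , y , xy , p , q = toWitness {a? = isEdge? φ u v} e in
                    fromWitness {a? = isVertex? φ u} (x , p)
    ; edge-adj  = λ {u} {v} e → let x , y , xy , p , q = toWitness {a? = isEdge? φ u v} e in
                    subst₂ (Adj G) p q (hom xy)
    }

  image-≈ : ∀ {φ ψ} (homφ : Homomorphism φ) (homψ : Homomorphism ψ) →
            (∀ x → φ x ≡ ψ x) → image φ homφ ≈ image ψ homψ
  image-≈ {φ} {ψ} _ _ φ≗ψ =
      (λ v → isYes-⇔ (isVertex? φ v) (isVertex? ψ v)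
         (λ (x , p) → x , trans (sym (φ≗ψ x)) p)
         (λ (x , p) → x , trans (φ≗ψ x) p))
    , (λ u v → isYes-⇔ (isEdge? φ u v) (isEdge? ψ u v)
         (λ (x , y , xy , p , q) → x , y , xy , trans (sym (φ≗ψ x)) p , trans (sym (φ≗ψ y)) q)
         (λ (x , y , xy , p , q) → x , y , xy , trans (φ≗ψ x) p , trans (φ≗ψ y) q))

  image-≅ : ∀ {φ} (hom : Homomorphism φ) → (∀ {x y} → φ x ≡ φ y → x ≡ y) → asGraph (image φ hom) ≅ Γ
  image-≅ {φ} hom φ-injective = record
    { bijection = mk↔ₛ′ to from to-from from-to
    ; adj⇔adj   = λ { (u , tu) (v , tv) → mk⇔ (to-adj u tu v tv) (from-adj u tu v tv) }
    }
    where
    preimage : ∀ v → T (isYes (isVertex? φ v)) → IsVertex φ v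
    preimage v t = toWitness {a? = isVertex? φ v} t

    to : V (asGraph (image φ hom)) → V Γ
    to (v , t) = proj₁ (preimage v t)

    from : V Γ → V (asGraph (image φ hom))
    from x = φ x , fromWitness {a? = isVertex? φ (φ x)} (x , refl)

    to-from : ∀ x → to (from x) ≡ x
    to-from x = φ-injective (proj₂ (preimage (φ x) _))

    from-to : ∀ v → from (to v) ≡ v
    from-to (v , t) with x , refl ← preimage v t = cong (φ x ,_) (T-irrelevant _ t)

    to-adj : ∀ u tu v tv → T (isYes (isEdge? φ u v)) → Adj Γ (to (u , tu)) (to (v , tv))
    to-adj u tu v tv e =
      let x , y , xy , p , q = toWitness {a? = isEdge? φ u v} e in
      subst₂ (Adj Γ) (φ-injective (trans p (sym (proj₂ (preimage u tu)))))
                     (φ-injective (trans q (sym (proj₂ (preimage v tv))))) xy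

    from-adj : ∀ u tu v tv → Adj Γ (to (u , tu)) (to (v , tv)) → T (isYes (isEdge? φ u v))
    from-adj u tu v tv xy =
      fromWitness {a? = isEdge? φ u v} (_ , _ , xy , proj₂ (preimage u tu) , proj₂ (preimage v tv))

  image-maps : ∀ (σ : V G ↔ V G) {φ ψ} (homφ : Homomorphism φ) (homψ : Homomorphism ψ) →
               (∀ x → ψ x ≡ Inverse.to σ (φ x)) → Maps σ (image φ homφ) (image ψ homψ)
  image-maps σ {φ} {ψ} _ _ ψ≗σφ =
      (λ v → isYes-⇔ (isVertex? ψ (to v)) (isVertex? φ v)
         (λ (x , p) → x , undo x p)
         (λ (x , p) → x , redo x p))
    , (λ u v → isYes-⇔ (isEdge? ψ (to u) (to v)) (isEdge? φ u v)
         (λ (x , y , xy , p , q) → x , y , xy , undo x p , undo y q)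
         (λ (x , y , xy , p , q) → x , y , xy , redo x p , redo y q))
    where
    open Inverse σ using (to; from)
    undo : ∀ x {v} → ψ x ≡ to v → φ x ≡ v
    undo x {v} p = trans (sym (Inverse.strictlyInverseʳ σ (φ x)))
                     (trans (cong from (trans (sym (ψ≗σφ x)) p)) (Inverse.strictlyInverseʳ σ v))
    redo : ∀ x {v} → φ x ≡ v → ψ x ≡ to v
    redo x p = trans (ψ≗σφ x) (cong to p)

≈-refl : ∀ {G} (A : Subgraph G) → A ≈ A
≈-refl A = (λ _ → refl) , λ _ _ → refl

≈-sym : ∀ {G} (A B : Subgraph G) → A ≈ B → B ≈ A
≈-sym A B (p , q) = (λ v → sym (p v)) , (λ u v → sym (q u v))

≈-trans : ∀ {G} (A B C : Subgraph G) → A ≈ B → B ≈ C → A ≈ C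
≈-trans A B C (p , q) (p′ , q′) = (λ v → trans (p v) (p′ v)) , (λ u v → trans (q u v) (q′ u v))

≈⇒≅ : ∀ {G Γ} (A B : Subgraph G) → A ≈ B → asGraph B ≅ Γ → asGraph A ≅ Γ
≈⇒≅ {G} {Γ} A B (p , q) B≅Γ = record
  { bijection = mk↔ₛ′ (to ∘ cast p) (cast (sym ∘ p) ∘ from)
      (λ x → trans (cong to (cast-inverse p (sym ∘ p) (from x))) (strictlyInverseˡ x))
      (λ v → trans (cong (cast (sym ∘ p)) (strictlyInverseʳ (cast p v))) (cast-inverse (sym ∘ p) p v))
  ; adj⇔adj = λ u v → mk⇔
      (λ e → Equivalence.to (_≅_.adj⇔adj B≅Γ (cast p u) (cast p v)) (subst T (q _ _) e))
      (λ a → subst T (sym (q _ _)) (Equivalence.from (_≅_.adj⇔adj B≅Γ (cast p u) (cast p v)) a))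
  }
  where
  open Inverse (_≅_.bijection B≅Γ) using (to; from; strictlyInverseˡ; strictlyInverseʳ)
  cast : ∀ {f g : V G → Bool} → (∀ v → f v ≡ g v) → ∃[ v ] T (f v) → ∃[ v ] T (g v)
  cast p (v , t) = v , subst T (p v) t
  cast-inverse : ∀ {f g : V G → Bool} (p : ∀ v → f v ≡ g v) (p′ : ∀ v → g v ≡ f v) w →
                 cast p (cast p′ w) ≡ w
  cast-inverse p p′ (v , t) = cong (v ,_) (T-irrelevant _ t)

Maps-resp-≈ : ∀ {G} (σ : V G ↔ V G) (A A′ B B′ : Subgraph G) →
              A ≈ A′ → B ≈ B′ → Maps σ A B → Maps σ A′ B′
Maps-resp-≈ σ A A′ B B′ (p , q) (p′ , q′) (mv , me) =
    (λ v → trans (sym (p′ _)) (trans (mv v) (p v)))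
  , (λ u v → trans (sym (q′ _ _)) (trans (me u v) (q u v)))

-- From labellings to cyclic decompositions

-- A labelling of the two sides of a bipartite graph by heights. Side 1ℙ is to be
-- read as carrying the negative labels -1 - height, so that the endpoints of an
-- edge differ by 1 plus the sum of their heights.
record SumLabelling (Γ : Graph) (n s H : ℕ) : Set where
  field
    side             : V Γ → Parity
    height           : Fin n → V Γ → ℕ
    bipartite        : ∀ {x y} → Adj Γ x y → side y ≡ side x ⁻¹
    height<H         : ∀ b x → height b x < H
    height-injective : ∀ b {x y} → side x ≡ side y → height b x ≡ height b y → x ≡ y
    sum<H            : ∀ b {x y} → Adj Γ x y → height b x + height b y < H
    s∤1+sum          : ∀ b {x y} → Adj Γ x y → ¬ s ∣ suc (height b x + height b y)
    sum-surjective   : ∀ {γ} → γ < H → ¬ s ∣ suc γ →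
                       ∃[ b ] ∃[ x ] ∃[ y ] (Adj Γ x y × height b x + height b y ≡ γ)
    sum-injective    : ∀ {b b′ x y x′ y′} → Adj Γ x y → Adj Γ x′ y′ →
                       height b x + height b y ≡ height b′ x′ + height b′ y′ →
                       b ≡ b′ × (x ≡ x′ × y ≡ y′ ⊎ x ≡ y′ × y ≡ x′)

module FromLabelling
  {Γ G : Graph} (search : Searchable (V Γ)) (adj? : B.Decidable (Adj Γ)) (_≟_ : DecidableEquality (V G))
  {n s H N : ℕ} .{{_ : NonZero s}} .{{_ : NonZero N}} (s∣H : s ∣ H) (N≡H+H : N ≡ H + H)
  (vertex : Fin N ↔ V G)
  (adj⇔ : ∀ i j → Adj G (Inverse.to vertex i) (Inverse.to vertex j) ⇔ (toℕ i % s ≢ toℕ j % s))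
  (labelling : SumLabelling Γ n s H) where

  open SumLabelling labelling
  open Congruence N
  module Modₛ = Congruence s
  open Image {Γ} {G} search adj? _≟_

  c : Fin N → V G
  c = Inverse.to vertex

  c⁻¹ : V G → Fin N
  c⁻¹ = Inverse.from vertex

  s∣N : s ∣ N
  s∣N = subst (s ∣_) (sym N≡H+H) (∣m∣n⇒∣m+n s∣H s∣H)

  H≤N : H ≤ N
  H≤N = subst (H ≤_) (sym N≡H+H) (m≤m+n H H)

  ∼⇒∼ₛ : ∀ {a b} → a ∼ b → a Modₛ.∼ b
  ∼⇒∼ₛ {a} {b} (mod≡ p) = Modₛ.mod≡ (begin
    a % s      ≡⟨ m∣n⇒o%n%m≡o%m s N a s∣N ⟨
    a % N % s  ≡⟨ cong (_% s) p ⟩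
    b % N % s  ≡⟨ m∣n⇒o%n%m≡o%m s N b s∣N ⟩
    b % s      ∎)
    where open ≡-Reasoning

  point : ℕ → V G
  point a = c (a mod N)

  point-cong : ∀ {a b} → a ∼ b → point a ≡ point b
  point-cong {a} {b} (mod≡ p) =
    cong c (toℕ-injective (trans (toℕ-mod a N) (trans p (sym (toℕ-mod b N)))))

  point-injective : ∀ {a b} → point a ≡ point b → a ∼ b
  point-injective {a} {b} p = mod≡ (begin
    a % N          ≡⟨ toℕ-mod a N ⟨
    toℕ (a mod N)  ≡⟨ cong toℕ (Injection.injective (Inverse⇒Injection vertex) p) ⟩
    toℕ (b mod N)  ≡⟨ toℕ-mod b N ⟩
    b % N          ∎)
    where open ≡-Reasoning

  index : V G → ℕ
  index v = toℕ (c⁻¹ v)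

  point-index : ∀ v → point (index v) ≡ v
  point-index v = trans (cong c (toℕ-injective eq)) (Inverse.strictlyInverseˡ vertex v)
    where
    eq : toℕ (index v mod N) ≡ index v
    eq = trans (toℕ-mod (index v) N) (m<n⇒m%n≡m (toℕ<n (c⁻¹ v)))

  toℕ-mod-∼ₛ : ∀ a → toℕ (a mod N) Modₛ.∼ a
  toℕ-mod-∼ₛ a = ∼⇒∼ₛ (∼-reflexive (toℕ-mod a N) ∙ %∼ a)

  point-adj : ∀ {a b} → ¬ a Modₛ.∼ b → Adj G (point a) (point b)
  point-adj {a} {b} a≁b = Equivalence.from (adj⇔ (a mod N) (b mod N)) λ p →
    a≁b (Modₛ.∼-sym (toℕ-mod-∼ₛ a) Modₛ.∙ Modₛ.mod≡ p Modₛ.∙ toℕ-mod-∼ₛ b)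

  adj-index : ∀ {u v} → Adj G u v → ¬ index u Modₛ.∼ index v
  adj-index {u} {v} uv (Modₛ.mod≡ p) =
    Equivalence.to (adj⇔ (c⁻¹ u) (c⁻¹ v))
      (subst₂ (Adj G) (sym (Inverse.strictlyInverseˡ vertex u))
                      (sym (Inverse.strictlyInverseˡ vertex v)) uv) p

  -- The integer labels `a` and `-1 - a`, translated by `H`. For heights below `H`, side `0ℙ` lands
  -- in `[H, 2H)` and side `1ℙ` in `[0, H)`, so the sides never collide.
  offset : Parity → ℕ → ℕ
  offset 0ℙ a = H + a
  offset 1ℙ a = H ∸ suc a

  label : Fin n → V Γ → ℕ
  label b x = offset (side x) (height b x)

  offset<N : ∀ p {a} → a < H → offset p a < N
  offset<N 0ℙ a<H = subst (H + _ <_) (sym N≡H+H) (+-monoʳ-< H a<H)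
  offset<N 1ℙ {a} a<H = <-≤-trans (∸-monoʳ-< z<s a<H) H≤N

  offset-injective : ∀ p q {a b} → a < H → b < H → offset p a ≡ offset q b → p ≡ q × a ≡ b
  offset-injective 0ℙ 0ℙ a<H b<H eq = refl , +-cancelˡ-≡ H _ _ eq
  offset-injective 0ℙ 1ℙ {a} a<H b<H eq =
    contradiction eq (>⇒≢ (<-≤-trans (∸-monoʳ-< z<s b<H) (m≤m+n H a)))
  offset-injective 1ℙ 0ℙ {b = b} a<H b<H eq =
    contradiction eq (<⇒≢ (<-≤-trans (∸-monoʳ-< z<s a<H) (m≤m+n H b)))
  offset-injective 1ℙ 1ℙ a<H b<H eq = refl , suc-injective (∸-cancelˡ-≡ a<H b<H eq)

  label<N : ∀ b x → label b x < N
  label<N b x = offset<N (side x) (height<H b x)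

  label-injective : ∀ b {x y} → label b x ≡ label b y → x ≡ y
  label-injective b {x} {y} eq =
    let p , q = offset-injective (side x) (side y) (height<H b x) (height<H b y) eq in
    height-injective b p q

  rise : Fin n → V Γ → V Γ → ℕ
  rise b x y = suc (height b x + height b y)

  -- `sum<H` only bounds the rise by `H` inclusively; equality is excluded because `s` divides `H`
  -- but not the rise.
  rise<H : ∀ b {x y} → Adj Γ x y → rise b x y < H
  rise<H b xy = ≤∧≢⇒< (sum<H b xy) λ eq → s∤1+sum b xy (subst (s ∣_) (sym eq) s∣H)

  -- Orients an edge from its negative to its nonnegative label, so that the difference of the
  -- labels is the positive number `rise`.
  Ascending : V Γ → V Γ → Set
  Ascending x y = Adj Γ x y × side x ≡ 1ℙ × side y ≡ 0ℙ

  ascending : ∀ {x y} → Adj Γ x y → Ascending x y ⊎ Ascending y x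
  ascending {x} {y} xy with side x | side y | bipartite xy
  ... | 0ℙ | 1ℙ | _ = inj₂ (symm Γ xy , refl , refl)
  ... | 1ℙ | 0ℙ | _ = inj₁ (xy , refl , refl)

  label-rise : ∀ b {x y} → Ascending x y → label b x + rise b x y ≡ label b y
  label-rise b {x} {y} (_ , p , q) rewrite p | q =
    trans (sym (+-assoc (H ∸ suc (height b x)) (suc (height b x)) (height b y)))
          (cong (_+ height b y) (m∸n+n≡m (height<H b x)))

  shifted-rise : ∀ b h {x y} → Ascending x y → h + label b x + rise b x y ≡ h + label b y
  shifted-rise b h {x} a = trans (+-assoc h (label b x) _) (cong (h +_) (label-rise b a))

  place : Fin n → ℕ → V Γ → V G
  place b h x = point (h + label b x)

  -- Modulo `s` the endpoints differ by the rise, so equal residues would make `s` divide it. Hence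
  -- every placed edge joins two different parts.
  ascending-≁ₛ : ∀ b h {x y} → Ascending x y → ¬ h + label b x Modₛ.∼ h + label b y
  ascending-≁ₛ b h {x} {y} a p =
    s∤1+sum b (proj₁ a) (m%n≡0⇒n∣m _ s (trans (Modₛ.%≡% rise∼0) (m<n⇒m%n≡m (>-nonZero⁻¹ s))))
    where
    rise∼0 : rise b x y Modₛ.∼ 0
    rise∼0 = Modₛ.+-cancelˡ-∼ (h + label b x)
      (Modₛ.∼-reflexive (shifted-rise b h a) Modₛ.∙ Modₛ.∼-sym p
       Modₛ.∙ Modₛ.∼-reflexive (sym (+-identityʳ _)))

  place-hom : ∀ b h → Homomorphism (place b h)
  place-hom b h xy with ascending xy
  ... | inj₁ a = point-adj (ascending-≁ₛ b h a)
  ... | inj₂ a = point-adj (ascending-≁ₛ b h a ∘ Modₛ.∼-sym)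

  place-injective : ∀ b h {x y} → place b h x ≡ place b h y → x ≡ y
  place-injective b h {x} {y} p =
    label-injective b (∼⇒≡ (label<N b x) (label<N b y) (+-cancelˡ-∼ h (point-injective p)))

  block : Fin n → ℕ → Subgraph G
  block b h = image (place b h) (place-hom b h)

  block-cong : ∀ {b h h′} → h ∼ h′ → block b h ≈ block b h′
  block-cong {b} {h} {h′} p =
    image-≈ (place-hom b h) (place-hom b h′) λ x → point-cong (+-cong-∼ p ∼-refl)

  -- Asking for `≈` instead of equality gives closure under `≈`. Shifts range over all of `ℕ`, with
  -- `block-cong` identifying them modulo `N`, so that rotating a block is just `suc h`.
  Blocks : Pred (Subgraph G) 0ℓ
  Blocks B = ∃[ b ] ∃[ h ] B ≈ block b h

  Covered : V G → V G → Set
  Covered u v = ∃[ B ] (B ∈ Blocks × T (edge B u v))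

  Covered-sym : ∀ {u v} → Covered u v → Covered v u
  Covered-sym (B , B∈ , e) = B , B∈ , edge-sym B e

  cover-edge : ∀ {u v b x y} → Ascending x y → index u + rise b x y ∼ index v → Covered u v
  cover-edge {u} {v} {b} {x} {y} a p =
    block b h , (b , h , ≈-refl (block b h)) ,
    fromWitness {a? = isEdge? (place b h) u v}
      ( x , y , proj₁ a
      , trans (point-cong at-u) (point-index u) , trans (point-cong at-v) (point-index v))
    where
    -- The shift that puts `x` at `u`, with `N ∸ label b x` standing for `- label b x` modulo `N`.
    -- The rise then carries `y` to `v`.
    h = index u + (N ∸ label b x)
    at-u : h + label b x ∼ index u
    at-u = ∼-reflexive (trans (+-assoc (index u) _ _)
                         (cong (index u +_) (m∸n+n≡m (<⇒≤ (label<N b x))))) ∙ +d∼ (index u)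
    at-v : h + label b y ∼ index v
    at-v = ∼-reflexive (sym (shifted-rise b h a)) ∙ +-cong-∼ at-u ∼-refl ∙ p

  cover-difference : ∀ {u v z} → z < H → ¬ s ∣ z → index u + z ∼ index v → Covered u v
  cover-difference {z = zero} _ s∤z _ = contradiction (s ∣0) s∤z
  cover-difference {u} {v} {z = suc γ} z<H s∤z p
    with b , x , y , xy , refl ← sum-surjective (<-trans (n<1+n γ) z<H) s∤z
    with ascending xy
  ... | inj₁ a = cover-edge a p
  ... | inj₂ a = cover-edge a
        (subst (λ γ → index u + suc γ ∼ index v) (+-comm (height b x) (height b y)) p)

  complement : ∀ {a} → a ≤ N → ∀ b → b + (N ∸ a) + a ∼ b
  complement a≤N b = ∼-reflexive (trans (+-assoc b _ _) (cong (b +_) (m∸n+n≡m a≤N))) ∙ +d∼ b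

  -- Let `z` be the difference from `u` to `v` modulo `N = 2H`. As `u` and `v` lie in different
  -- parts, `s` divides neither `z` nor `N ∸ z`; in particular `z` is not `H`. So one of the two is
  -- below `H` and is the rise of some edge, which covers the pair from `u` to `v` or from `v` to
  -- `u`.
  covers : ∀ {u v} → Adj G u v → Covered u v
  covers {u} {v} uv = trichotomy (<-cmp z H)
    where
    z = (index v + (N ∸ index u)) % N

    z<N : z < N
    z<N = m%n<n _ N

    u+z∼v : index u + z ∼ index v
    u+z∼v = +-cong-∼ ∼-refl (%∼ _) ∙ ∼-reflexive (+-comm (index u) _)
            ∙ complement (<⇒≤ (toℕ<n (c⁻¹ u))) (index v)

    v+[N∸z]∼u : index v + (N ∸ z) ∼ index u
    v+[N∸z]∼u = +-cong-∼ (∼-sym u+z∼v) ∼-refl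
      ∙ ∼-reflexive (trans (+-assoc (index u) z _)
          (trans (cong (index u +_) (+-comm z _)) (sym (+-assoc (index u) _ z))))
      ∙ complement (<⇒≤ z<N) (index u)

    s∤z : ¬ s ∣ z
    s∤z s∣z = adj-index uv
      (Modₛ.mod≡ (sym (%-remove-+ʳ (index u) s∣z)) Modₛ.∙ ∼⇒∼ₛ u+z∼v)

    s∤N∸z : ¬ s ∣ N ∸ z
    s∤N∸z s∣N∸z = s∤z (∣m+n∣m⇒∣n (subst (s ∣_) (sym (m∸n+n≡m (<⇒≤ z<N))) s∣N) s∣N∸z)

    trichotomy : Tri (z < H) (z ≡ H) (H < z) → Covered u v
    trichotomy (tri< z<H _ _) = cover-difference z<H s∤z u+z∼v
    trichotomy (tri≈ _ z≡H _) = contradiction (subst (s ∣_) (sym z≡H) s∣H) s∤z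
    trichotomy (tri> _ _ H<z) = Covered-sym (cover-difference N∸z<H s∤N∸z v+[N∸z]∼u)
      where
      N∸z<H : N ∸ z < H
      N∸z<H = subst (N ∸ z <_) (trans (cong (_∸ H) N≡H+H) (m+n∸n≡m H H)) (∸-monoʳ-< H<z (<⇒≤ z<N))

  -- Two edges placed on the same pair in the same direction have rises that agree modulo `N`, hence
  -- are equal, both being below `H`. Then `sum-injective` makes them the same labelled edge, and
  -- the position of `x` determines the shift.
  parallel : ∀ {b b′ h h′ x y x′ y′} → Ascending x y → Ascending x′ y′ →
             h + label b x ∼ h′ + label b′ x′ → h + label b y ∼ h′ + label b′ y′ →
             b ≡ b′ × h ∼ h′
  parallel {b} {b′} {h} {h′} {x} {y} {x′} {y′} a@(xy , sx , sy) a′@(xy′ , sx′ , sy′) p q =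
    conclude (sum-injective xy xy′ (suc-injective same-rise))
    where
    same-rise : rise b x y ≡ rise b′ x′ y′
    same-rise = ∼⇒≡ (<-≤-trans (rise<H b xy) H≤N) (<-≤-trans (rise<H b′ xy′) H≤N)
      (+-cancelˡ-∼ (h′ + label b′ x′)
        (+-cong-∼ (∼-sym p) ∼-refl ∙ ∼-reflexive (shifted-rise b h a) ∙ q
         ∙ ∼-reflexive (sym (shifted-rise b′ h′ a′))))
    conclude : b ≡ b′ × (x ≡ x′ × y ≡ y′ ⊎ x ≡ y′ × y ≡ x′) → b ≡ b′ × h ∼ h′
    conclude (refl , inj₁ (refl , _)) = refl , +-cancelˡ-∼ (label b x)
      (∼-reflexive (+-comm (label b x) h) ∙ p ∙ ∼-reflexive (+-comm h′ (label b x)))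
    -- Matching `x` with `y′` is impossible: they lie on sides `1ℙ` and `0ℙ`.
    conclude (_ , inj₂ (refl , _)) with () ← trans (sym sx) sy′

  -- Going up along one edge and then along the other would return to the start, so the two rises
  -- would add up to `0` modulo `N`. Their sum is positive and below `2H = N`.
  antiparallel : ∀ {b b′ h h′ x y x′ y′} → Ascending x y → Ascending x′ y′ →
                 h + label b x ∼ h′ + label b′ y′ → ¬ h + label b y ∼ h′ + label b′ x′
  antiparallel {b} {b′} {h} {h′} {x} {y} {x′} {y′} a a′ p q =
    contradiction (∼⇒≡ rises<N (>-nonZero⁻¹ N) rises∼0) λ ()
    where
    rises<N : rise b′ x′ y′ + rise b x y < N
    rises<N = subst (rise b′ x′ y′ + rise b x y <_) (sym N≡H+H)
      (+-mono-< (rise<H b′ (proj₁ a′)) (rise<H b (proj₁ a)))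
    rises∼0 : rise b′ x′ y′ + rise b x y ∼ 0
    rises∼0 = +-cancelˡ-∼ (h′ + label b′ x′)
      (∼-reflexive (trans (sym (+-assoc (h′ + label b′ x′) _ _))
         (cong (_+ rise b x y) (shifted-rise b′ h′ a′)))
       ∙ +-cong-∼ (∼-sym p) ∼-refl ∙ ∼-reflexive (shifted-rise b h a) ∙ q
       ∙ ∼-reflexive (sym (+-identityʳ _)))

  blocks-disjoint : ∀ {b b′ h h′ u v} → T (edge (block b h) u v) → T (edge (block b′ h′) u v) →
                    b ≡ b′ × h ∼ h′
  blocks-disjoint {b} {b′} {h} {h′} {u} {v} e e′
    with x , y , xy , p , q ← toWitness {a? = isEdge? (place b h) u v} e
       | x′ , y′ , xy′ , p′ , q′ ← toWitness {a? = isEdge? (place b′ h′) u v} e′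
    with at-u ← point-injective (trans p (sym p′)) | at-v ← point-injective (trans q (sym q′))
    with ascending xy | ascending xy′
  ... | inj₁ a | inj₁ a′ = parallel a a′ at-u at-v
  ... | inj₂ a | inj₂ a′ = parallel a a′ at-v at-u
  ... | inj₁ a | inj₂ a′ = contradiction at-v (antiparallel a a′ at-u)
  ... | inj₂ a | inj₁ a′ = contradiction at-u (antiparallel a a′ at-v)

  isDecomposition : IsDecomposition Γ G Blocks
  isDecomposition = record
    { resp-≈   = λ {B} {B′} B≈B′ (b , h , B≈) →
                   b , h , ≈-trans B′ B (block b h) (≈-sym B B′ B≈B′) B≈
    ; iso      = λ { {B} (b , h , B≈) →
                   ≈⇒≅ B (block b h) B≈ (image-≅ (place-hom b h) (place-injective b h)) }
    ; covers   = covers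
    ; disjoint = λ {B} {B′} → disjoint {B} {B′}
    }
    where
    disjoint : ∀ {B B′ u v} → B ∈ Blocks → B′ ∈ Blocks → T (edge B u v) → T (edge B′ u v) → B ≈ B′
    disjoint {B} {B′} (b , h , B≈@(_ , p)) (b′ , h′ , B′≈@(_ , p′)) e e′
      with refl , h∼h′ ← blocks-disjoint {b} {b′} {h} {h′} (subst T (p _ _) e) (subst T (p′ _ _) e′)
      = ≈-trans B (block b h) B′ B≈
          (≈-trans (block b h) (block b h′) B′ (block-cong h∼h′) (≈-sym B′ (block b h′) B′≈))

  rotation : V G ↔ V G
  rotation = vertex ↔-∘ (next↔ ↔-∘ ↔-sym vertex)

  rotation-point : ∀ a → point (suc a) ≡ Inverse.to rotation (point a)
  rotation-point a = trans (cong c (toℕ-injective eq))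
    (cong (c ∘ next) (sym (Inverse.strictlyInverseʳ vertex (a mod N))))
    where
    eq : toℕ (suc a mod N) ≡ toℕ (next (a mod N))
    eq = begin
      toℕ (suc a mod N)        ≡⟨ toℕ-mod (suc a) N ⟩
      suc a % N                ≡⟨ %≡% (+-cong-∼ (∼-refl {1}) (%∼ a)) ⟨
      suc (a % N) % N          ≡⟨ cong (λ r → suc r % N) (toℕ-mod a N) ⟨
      suc (toℕ (a mod N)) % N  ≡⟨ toℕ-next-% (a mod N) ⟨
      toℕ (next (a mod N))     ∎
      where open ≡-Reasoning

  block-maps : ∀ b h → Maps rotation (block b h) (block b (suc h))
  block-maps b h = image-maps rotation (place-hom b h) (place-hom b (suc h))
                     λ x → rotation-point (h + label b x)

  isCyclic : IsCyclic Blocks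
  isCyclic = rotation
    , (N , vertex , λ i → cong (c ∘ next) (Inverse.strictlyInverseʳ vertex i))
    , (λ { {B} (b , h , B≈) → let B₁ = block b h; B₂ = block b (suc h) in
           B₂ , (b , suc h , ≈-refl B₂)
         , Maps-resp-≈ rotation B₁ B B₂ B₂ (≈-sym B B₁ B≈) (≈-refl B₂) (block-maps b h) })
    -- `h + pred N` plays the role of `h - 1` modulo `N`, which also covers `h = 0`.
    , (λ { {B} (b , h , B≈) → let B₁ = block b (h + pred N); B₂ = block b (suc (h + pred N)) in
           B₁ , (b , h + pred N , ≈-refl B₁)
         , Maps-resp-≈ rotation B₁ B₁ B₂ B (≈-refl B₁)
             (≈-trans B₂ (block b h) B (block-cong (back h)) (≈-sym B (block b h) B≈))
             (block-maps b (h + pred N)) })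
    where
    back : ∀ h → suc (h + pred N) ∼ h
    back h = ∼-reflexive (trans (sym (+-suc h (pred N))) (cong (h +_) (suc-pred N))) ∙ +d∼ h

  hasCyclicDecomposition : HasCyclicDecomposition Γ G
  hasCyclicDecomposition = Blocks , isDecomposition , isCyclic

-- The cylinder over a labelled cycle

divMod-unique : ∀ {d a a′ q q′} .{{_ : NonZero d}} → a < d → a′ < d →
                a + q * d ≡ a′ + q′ * d → a ≡ a′ × q ≡ q′
divMod-unique {d} {a} {a′} {q} {q′} a<d a′<d eq = a≡a′ , *-cancelʳ-≡ q q′ d (+-cancelˡ-≡ a _ _
    (trans eq (cong (_+ q′ * d) (sym a≡a′))))
  where
  open ≡-Reasoning
  a≡a′ : a ≡ a′
  a≡a′ = begin
    a                  ≡⟨ m<n⇒m%n≡m a<d ⟨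
    a % d              ≡⟨ [m+kn]%n≡m%n a q d ⟨
    (a + q * d) % d    ≡⟨ cong (_% d) eq ⟩
    (a′ + q′ * d) % d  ≡⟨ [m+kn]%n≡m%n a′ q′ d ⟩
    a′ % d             ≡⟨ m<n⇒m%n≡m a′<d ⟩
    a′                 ∎

a+qd<nd : ∀ {a d q n} → a < d → q < n → a + q * d < n * d
a+qd<nd {d = d} {q} a<d q<n = <-≤-trans (+-monoˡ-< (q * d) a<d) (*-monoˡ-≤ d q<n)

-- The edge from `x` to `next x` is named by `x`. One labelling has to fill the window of sums below
-- `S`, and the cylinder stacks translates of this window.
record CycleLabelling (r s S : ℕ) : Set where
  field
    side             : Fin r → Parity
    height           : Fin r → ℕ
    alternating      : ∀ x → side (next x) ≡ side x ⁻¹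
    height-injective : ∀ {x y} → side x ≡ side y → height x ≡ height y → x ≡ y

  sum : Fin r → ℕ
  sum x = height x + height (next x)

  field
    sum<S          : ∀ x → sum x < S
    s∤1+sum        : ∀ x → ¬ s ∣ suc (sum x)
    sum-surjective : ∀ {γ} → γ < S → ¬ s ∣ suc γ → ∃[ x ] sum x ≡ γ
    sum-injective  : ∀ {x y} → sum x ≡ sum y → x ≡ y

rotate : ∀ {n} → ℕ → Fin n → Fin n
rotate zero    x = x
rotate (suc i) x = next (rotate i x)

rotate-injective : ∀ {n} i {x y : Fin n} → rotate i x ≡ rotate i y → x ≡ y
rotate-injective zero    p = p
rotate-injective (suc i) p = rotate-injective i (next-injective p)

rotate-next : ∀ {n} i (x : Fin n) → rotate i (next x) ≡ next (rotate i x)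
rotate-next zero    x = refl
rotate-next (suc i) x = cong next (rotate-next i x)

rotate-surjective : ∀ {n} i (x : Fin n) → ∃[ y ] rotate i y ≡ x
rotate-surjective zero    x = x , refl
rotate-surjective (suc i) x =
  let y , p = rotate-surjective i (prev x) in y , trans (cong next p) (next-prev x)

Consecutive : ℕ → ℕ → Set
Consecutive i j = j ≡ i ⊎ j ≡ suc i

⌊/2⌋-⌈/2⌉-consecutive : ∀ n → Consecutive ⌊ n /2⌋ ⌈ n /2⌉
⌊/2⌋-⌈/2⌉-consecutive zero          = inj₁ refl
⌊/2⌋-⌈/2⌉-consecutive (suc zero)    = inj₂ refl
⌊/2⌋-⌈/2⌉-consecutive (suc (suc n)) with ⌊/2⌋-⌈/2⌉-consecutive n
... | inj₁ p = inj₁ (cong suc p)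
... | inj₂ p = inj₂ (cong suc p)

⌊consecutive-sum/2⌋ : ∀ {i j} → Consecutive i j → ⌊ i + j /2⌋ ≡ i
⌊consecutive-sum/2⌋ {i} (inj₁ refl) = sym (n≡⌊n+n/2⌋ i)
⌊consecutive-sum/2⌋ {i} (inj₂ refl) = trans (cong ⌊_/2⌋ (+-suc i i)) (sym (n≡⌈n+n/2⌉ i))

-- Half the sum, rounded down, recovers `i`. So over a fixed edge of the base cycle, the layer sum
-- tells all edges of the cylinder apart.
consecutive-sum-injective : ∀ {i j i′ j′} → Consecutive i j → Consecutive i′ j′ →
                            i + j ≡ i′ + j′ → i ≡ i′ × j ≡ j′
consecutive-sum-injective {i} {j} {i′} {j′} c c′ p =
  i≡i′ , +-cancelˡ-≡ i _ _ (trans p (cong (_+ j′) (sym i≡i′)))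
  where
  i≡i′ : i ≡ i′
  i≡i′ = trans (sym (⌊consecutive-sum/2⌋ c)) (trans (cong ⌊_/2⌋ p) (⌊consecutive-sum/2⌋ c′))

module Cylinder {r s S} (3≤r : 3 ≤ r) (s∣S : s ∣ S) .{{_ : NonZero S}}
                (L : CycleLabelling r s S) (n m-1 : ℕ) where

  open CycleLabelling L

  Γ : Graph
  Γ = cycle r 3≤r □ path (suc m-1)

  -- With `m` layers, `W` is `2m - 1`, the number of possible layer sums `0`, ..., `m-1 + m-1`.
  W H : ℕ
  W = suc (m-1 + m-1)
  H = n * W * S

  -- In the coordinates (x , i) with x = base (j , i), every edge joins x to next x
  -- and stays in a layer or moves one layer up.
  base : V Γ → Fin r
  base (j , i) = rotate (toℕ i) j

  layer : V Γ → ℕ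
  layer (j , i) = toℕ i

  vertex-ext : ∀ {v w} → base v ≡ base w → layer v ≡ layer w → v ≡ w
  vertex-ext {j , i} {j′ , i′} p q with refl ← toℕ-injective q = cong (_, i) (rotate-injective (toℕ i) p)

  record Arc (v w : V Γ) : Set where
    constructor arc
    field
      base-next : base w ≡ next (base v)
      ascent    : Consecutive (layer v) (layer w)

  open Arc

  adj⇒arc : ∀ {v w} → Adj Γ v w → Arc v w ⊎ Arc w v
  adj⇒arc {j , i} (inj₁ (inj₁ refl , refl)) = inj₁ (arc (rotate-next (toℕ i) j) (inj₁ refl))
  adj⇒arc {w = j , i} (inj₁ (inj₂ refl , refl)) = inj₂ (arc (rotate-next (toℕ i) j) (inj₁ refl))
  adj⇒arc {j , i} (inj₂ (refl , inj₁ p)) = inj₁ (arc (cong (λ i → rotate i j) (sym p)) (inj₂ (sym p)))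
  adj⇒arc {w = j , i} (inj₂ (refl , inj₂ p)) = inj₂ (arc (cong (λ i → rotate i j) (sym p)) (inj₂ (sym p)))

  arc⇒adj : ∀ {v w} → Arc v w → Adj Γ v w
  arc⇒adj {j , i} {j′ , i′} (arc p (inj₁ q)) with refl ← toℕ-injective q =
    inj₁ (inj₁ (rotate-injective (toℕ i) (trans (rotate-next (toℕ i) j) (sym p))) , refl)
  arc⇒adj {j , i} {j′ , i′} (arc p (inj₂ q)) =
    inj₂ (rotate-injective (suc (toℕ i)) (trans (sym p) (cong (λ i → rotate i j′) q)) , inj₁ (sym q))

  vside : V Γ → Parity
  vside v = side (base v)

  -- Only side `1ℙ` is raised. Each edge has exactly one endpoint there, so all its sums move by
  -- `b * W`, while heights on one side keep their differences.
  shift : Parity → ℕ → ℕ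
  shift 0ℙ b = 0
  shift 1ℙ b = b * W

  shifts : ∀ p b → shift p b + shift (p ⁻¹) b ≡ b * W
  shifts 0ℙ b = refl
  shifts 1ℙ b = +-identityʳ (b * W)

  level : Fin n → V Γ → ℕ
  level b v = layer v + shift (vside v) (toℕ b)

  vheight : Fin n → V Γ → ℕ
  vheight b v = height (base v) + level b v * S

  arc-side : ∀ {v w} → Arc v w → vside w ≡ vside v ⁻¹
  arc-side {v} e = trans (cong side (base-next e)) (alternating (base v))

  -- This is a mixed-radix expansion with digits `sum (base v) < S`, `layer v + layer w < W` and
  -- `toℕ b < n`. Existence and uniqueness of the digits yield the surjectivity and injectivity of
  -- the sums.
  arc-sum : ∀ b {v w} → Arc v w →
            vheight b v + vheight b w ≡ sum (base v) + (layer v + layer w + toℕ b * W) * S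
  arc-sum b {v} {w} e = begin
    vheight b v + vheight b w
      ≡⟨ regroup (height (base v)) (height (base w)) (layer v) (layer w) (shift (vside v) (toℕ b)) _ S ⟩
    height (base v) + height (base w) + (layer v + layer w + (shift (vside v) (toℕ b) + shift (vside w) (toℕ b))) * S
      ≡⟨ cong₂ (λ y t → height (base v) + height y + (layer v + layer w + t) * S) (base-next e)
           (trans (cong (λ p → shift (vside v) (toℕ b) + shift p (toℕ b)) (arc-side e)) (shifts (vside v) (toℕ b))) ⟩
    sum (base v) + (layer v + layer w + toℕ b * W) * S ∎
    where
    open ≡-Reasoning
    regroup : ∀ h h′ i i′ t t′ S → h + (i + t) * S + (h′ + (i′ + t′) * S) ≡ h + h′ + (i + i′ + (t + t′)) * S
    regroup = solve-∀

  layers<W : ∀ v w → layer v + layer w < W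
  layers<W (_ , i) (_ , i′) = s≤s (+-mono-≤ (s≤s⁻¹ (toℕ<n i)) (s≤s⁻¹ (toℕ<n i′)))

  arc-sum<H : ∀ b {v w} → Arc v w → vheight b v + vheight b w < H
  arc-sum<H b {v} {w} e = subst (_< H) (sym (arc-sum b e))
    (a+qd<nd (sum<S (base v)) (a+qd<nd (layers<W v w) (toℕ<n b)))

  s∤1+arc-sum : ∀ b {v w} → Arc v w → ¬ s ∣ suc (vheight b v + vheight b w)
  s∤1+arc-sum b {v} {w} e s∣ = s∤1+sum (base v)
    (∣m+n∣m⇒∣n (subst (s ∣_) (trans (cong suc (arc-sum b e)) (+-comm (suc (sum (base v))) _)) s∣)
             (∣n⇒∣m*n (layer v + layer w + toℕ b * W) s∣S))

  arc-sum-surjective : ∀ {γ} → γ < H → ¬ s ∣ suc γ →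
                       ∃[ b ] ∃[ v ] ∃[ w ] (Arc v w × vheight b v + vheight b w ≡ γ)
  arc-sum-surjective {γ} γ<H s∤1+γ =
    b , (j , i) , (j′ , i′) , e ,
    trans (arc-sum b e)
      (trans (cong₂ _+_ sum≡ (cong (_* S) level≡)) (sym (m≡m%n+[m/n]*n γ S)))
    where
    -- The digits of `γ` are read off: `γ % S` selects the base edge, the two halves of `p` are the
    -- layers of its ends, and `q / W` is the copy.
    q = γ / S
    p = q % W
    found : ∃[ x ] sum x ≡ γ % S
    found = sum-surjective (m%n<n γ S) λ s∣ → s∤1+γ
      (subst (λ γ → s ∣ suc γ) (sym (m≡m%n+[m/n]*n γ S)) (∣m∣n⇒∣m+n s∣ (∣n⇒∣m*n q s∣S)))
    x = proj₁ found
    q/W<n : q / W < n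
    q/W<n = m<n*o⇒m/o<n (m<n*o⇒m/o<n γ<H)
    b = fromℕ< q/W<n
    ⌈p/2⌉<m : ⌈ p /2⌉ < suc m-1
    ⌈p/2⌉<m = s≤s (≤-trans (⌈n/2⌉-mono (s≤s⁻¹ (m%n<n q W))) (≤-reflexive (sym (n≡⌈n+n/2⌉ m-1))))
    ⌊p/2⌋<m : ⌊ p /2⌋ < suc m-1
    ⌊p/2⌋<m = ≤-<-trans (⌊n/2⌋≤⌈n/2⌉ p) ⌈p/2⌉<m
    i = fromℕ< ⌊p/2⌋<m
    i′ = fromℕ< ⌈p/2⌉<m
    j = proj₁ (rotate-surjective (toℕ i) x)
    j′ = proj₁ (rotate-surjective (toℕ i′) (next x))
    e : Arc (j , i) (j′ , i′)
    e = arc (trans (proj₂ (rotate-surjective (toℕ i′) (next x)))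
                   (cong next (sym (proj₂ (rotate-surjective (toℕ i) x)))))
            (subst₂ Consecutive (sym (toℕ-fromℕ< ⌊p/2⌋<m)) (sym (toℕ-fromℕ< ⌈p/2⌉<m))
              (⌊/2⌋-⌈/2⌉-consecutive p))
    sum≡ : sum (base (j , i)) ≡ γ % S
    sum≡ = trans (cong sum (proj₂ (rotate-surjective (toℕ i) x))) (proj₂ found)
    level≡ : toℕ i + toℕ i′ + toℕ b * W ≡ q
    level≡ = trans (cong₂ _+_ (trans (cong₂ _+_ (toℕ-fromℕ< ⌊p/2⌋<m) (toℕ-fromℕ< ⌈p/2⌉<m))
                                     (⌊n/2⌋+⌈n/2⌉≡n p))
                              (cong (_* W) (toℕ-fromℕ< q/W<n)))
                   (sym (m≡m%n+[m/n]*n q W))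

  arc-sum-injective : ∀ {b b′ v w v′ w′} → Arc v w → Arc v′ w′ →
                      vheight b v + vheight b w ≡ vheight b′ v′ + vheight b′ w′ →
                      b ≡ b′ × v ≡ v′ × w ≡ w′
  arc-sum-injective {b} {b′} {v} {w} {v′} {w′} e e′ p =
    let q , q′ = divMod-unique (sum<S (base v)) (sum<S (base v′))
                   (trans (sym (arc-sum b e)) (trans p (arc-sum b′ e′)))
        t , t′ = divMod-unique (layers<W v w) (layers<W v′ w′) q′
        u , u′ = consecutive-sum-injective (ascent e) (ascent e′) t
        x≡x′   = sum-injective q
    in toℕ-injective t′ , vertex-ext x≡x′ u
       , vertex-ext (trans (base-next e) (trans (cong next x≡x′) (sym (base-next e′)))) u′

  height<S : ∀ x → height x < S
  height<S x = ≤-<-trans (m≤m+n _ _) (sum<S x)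

  vheight-injective : ∀ b {v w} → vside v ≡ vside w → vheight b v ≡ vheight b w → v ≡ w
  vheight-injective b {v} {w} side≡ p =
    let q , q′ = divMod-unique (height<S (base v)) (height<S (base w)) p
    in vertex-ext (height-injective side≡ q)
         (+-cancelʳ-≡ _ _ _ (trans q′ (cong (λ p → layer w + shift p (toℕ b)) (sym side≡))))

  -- The height is at most the sum along the arc to the next vertex of the same layer.
  vheight<H : ∀ b v → vheight b v < H
  vheight<H b v@(j , i) = ≤-<-trans (m≤m+n _ (vheight b (next j , i)))
    (arc-sum<H b {v} (arc (rotate-next (toℕ i) j) (inj₁ refl)))

  sumLabelling : SumLabelling Γ n s H
  sumLabelling = record
    { side             = vside
    ; height           = vheight
    ; bipartite        = bip
    ; height<H         = vheight<H
    ; height-injective = vheight-injective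
    ; sum<H            = λ b → symmetrically b (_< H) (arc-sum<H b)
    ; s∤1+sum          = λ b → symmetrically b (λ γ → ¬ s ∣ suc γ) (s∤1+arc-sum b)
    ; sum-surjective   = λ γ<H s∤ → let b , v , w , e , p = arc-sum-surjective γ<H s∤ in
                           b , v , w , arc⇒adj e , p
    ; sum-injective    = sum-inj
    }
    where
    bip : ∀ {v w} → Adj Γ v w → vside w ≡ vside v ⁻¹
    bip {v} {w} vw with adj⇒arc vw
    ... | inj₁ e = arc-side e
    ... | inj₂ e = trans (sym (⁻¹-involutive (vside w))) (cong _⁻¹ (sym (arc-side e)))

    symmetrically : ∀ b (P : ℕ → Set) → (∀ {v w} → Arc v w → P (vheight b v + vheight b w)) →
                    ∀ {v w} → Adj Γ v w → P (vheight b v + vheight b w)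
    symmetrically b P f {v} {w} vw with adj⇒arc vw
    ... | inj₁ e = f e
    ... | inj₂ e = subst P (+-comm (vheight b w) (vheight b v)) (f e)

    sum-inj : ∀ {b b′ v w v′ w′} → Adj Γ v w → Adj Γ v′ w′ →
              vheight b v + vheight b w ≡ vheight b′ v′ + vheight b′ w′ →
              b ≡ b′ × (v ≡ v′ × w ≡ w′ ⊎ v ≡ w′ × w ≡ v′)
    sum-inj {b} {b′} {v} {w} {v′} {w′} vw vw′ p with adj⇒arc vw | adj⇒arc vw′
    ... | inj₁ e | inj₁ e′ =
      let q , t , u = arc-sum-injective e e′ p in q , inj₁ (t , u)
    ... | inj₁ e | inj₂ e′ =
      let q , t , u = arc-sum-injective e e′ (trans p (+-comm (vheight b′ v′) _)) in q , inj₂ (t , u)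
    ... | inj₂ e | inj₁ e′ =
      let q , t , u = arc-sum-injective e e′ (trans (+-comm (vheight b w) _) p) in q , inj₂ (u , t)
    ... | inj₂ e | inj₂ e′ =
      let q , t , u = arc-sum-injective e e′
            (trans (+-comm (vheight b w) _) (trans p (+-comm (vheight b′ v′) _)))
      in q , inj₁ (u , t)

-- Labelling the cycle on 4k vertices

parity-suc : ∀ n → parity (suc n) ≡ parity n ⁻¹
parity-suc n = trans (sym (⁻¹-involutive _)) (cong _⁻¹ (suc-homo-⁻¹ n))

toℕ-next-< : ∀ {n} (x : Fin n) → suc (toℕ x) < n → toℕ (next x) ≡ suc (toℕ x)
toℕ-next-< {suc n} x 1+x<n = trans (toℕ-next x) (m<n⇒m%n≡m 1+x<n)

toℕ-next-≡ : ∀ {n} (x : Fin n) → suc (toℕ x) ≡ n → toℕ (next x) ≡ 0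
toℕ-next-≡ {suc n} x 1+x≡n = trans (toℕ-next x) (trans (cong (_% suc n) 1+x≡n) (n%n≡0 (suc n)))

interchange : ∀ a b c d → a + b + (c + d) ≡ a + c + (b + d)
interchange = solve-∀

module ZigZag (gap : ℕ) (1≤gap : 1 ≤ gap) where

  oddℕ : ℕ → ℕ
  oddℕ zero          = 0
  oddℕ (suc zero)    = 1
  oddℕ (suc (suc n)) = oddℕ n

  oddℕ+oddℕ-suc : ∀ n → oddℕ n + oddℕ (suc n) ≡ 1
  oddℕ+oddℕ-suc zero          = refl
  oddℕ+oddℕ-suc (suc zero)    = refl
  oddℕ+oddℕ-suc (suc (suc n)) = oddℕ+oddℕ-suc n

  -- The correction term makes the sums of neighbours skip the value gap.
  zigzag : ℕ → ℕ
  zigzag x = ⌊ x /2⌋ + oddℕ (x ∸ gap)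

  step : ℕ → ℕ
  step x = zigzag x + zigzag (suc x)

  step-regroup : ∀ x → step x ≡ x + (oddℕ (x ∸ gap) + oddℕ (suc x ∸ gap))
  step-regroup x = trans (interchange ⌊ x /2⌋ _ ⌈ x /2⌉ _)
    (cong (_+ (oddℕ (x ∸ gap) + oddℕ (suc x ∸ gap))) (⌊n/2⌋+⌈n/2⌉≡n x))

  step-below : ∀ {x} → x < gap → step x ≡ x
  step-below {x} x<gap = trans (step-regroup x)
    (trans (cong₂ (λ u v → x + (oddℕ u + oddℕ v))
             (m≤n⇒m∸n≡0 (<⇒≤ x<gap)) (m≤n⇒m∸n≡0 x<gap)) (+-identityʳ x))

  -- From `gap` on, exactly one of two successive distances to `gap` is odd, so each step receives
  -- the correction exactly once.
  step-above : ∀ {x} → gap ≤ x → step x ≡ suc x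
  step-above {x} gap≤x = begin
    step x
      ≡⟨ step-regroup x ⟩
    x + (oddℕ (x ∸ gap) + oddℕ (suc x ∸ gap))
      ≡⟨ cong (λ u → x + (oddℕ (x ∸ gap) + oddℕ u)) (+-∸-assoc 1 gap≤x) ⟩
    x + (oddℕ (x ∸ gap) + oddℕ (suc (x ∸ gap)))
      ≡⟨ cong (x +_) (oddℕ+oddℕ-suc (x ∸ gap)) ⟩
    x + 1
      ≡⟨ +-comm x 1 ⟩
    suc x ∎
    where open ≡-Reasoning

  step≤ : ∀ x → step x ≤ suc x
  step≤ x with <-≤-connex x gap
  ... | inj₁ x<gap = ≤-trans (≤-reflexive (step-below x<gap)) (n≤1+n x)
  ... | inj₂ gap≤x = ≤-reflexive (step-above gap≤x)

  step-mono-< : ∀ {x y} → x < y → step x < step y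
  step-mono-< {x} {y} x<y with <-≤-connex y gap
  ... | inj₁ y<gap = subst₂ _<_ (sym (step-below (<-trans x<y y<gap))) (sym (step-below y<gap)) x<y
  ... | inj₂ gap≤y = subst (step x <_) (sym (step-above gap≤y)) (s≤s (≤-trans (step≤ x) x<y))

  step-injective : ∀ {x y} → step x ≡ step y → x ≡ y
  step-injective {x} {y} p with <-cmp x y
  ... | tri< x<y _ _ = contradiction p (<⇒≢ (step-mono-< x<y))
  ... | tri≈ _ x≡y _ = x≡y
  ... | tri> _ _ x>y = contradiction p (>⇒≢ (step-mono-< x>y))

  zigzag-1 : zigzag 1 ≡ 0
  zigzag-1 = cong oddℕ (m≤n⇒m∸n≡0 1≤gap)

  zigzag-0 : zigzag 0 ≡ 0
  zigzag-0 = cong oddℕ (0∸n≡0 gap)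

  -- The steps at `x` and `suc x` share the term `zigzag (suc x)`, so comparing them compares the
  -- outer terms.
  zigzag-2+ : ∀ x → zigzag x < zigzag (2 + x)
  zigzag-2+ x = +-cancelˡ-< (zigzag (suc x)) _ _
    (subst (_< step (suc x)) (+-comm (zigzag x) _) (step-mono-< (n<1+n x)))

  zigzag-mono-< : ∀ {x y} → parity x ≡ parity y → x < y → zigzag x < zigzag y
  zigzag-mono-< {x} {suc zero} p (s≤s z≤n) with () ← p
  zigzag-mono-< {x} {suc (suc y)} p x<2+y with m≤n⇒m<n∨m≡n (s≤s⁻¹ x<2+y)
  ... | inj₂ refl = contradiction (trans (sym p) (parity-suc y)) (p≢p⁻¹ _)
  ... | inj₁ x<1+y with m≤n⇒m<n∨m≡n (s≤s⁻¹ x<1+y)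
  ...   | inj₁ x<y = <-trans (zigzag-mono-< p x<y) (zigzag-2+ y)
  ...   | inj₂ refl = zigzag-2+ y

  zigzag-injective : ∀ {x y} → parity x ≡ parity y → zigzag x ≡ zigzag y → x ≡ y
  zigzag-injective {x} {y} p q with <-cmp x y
  ... | tri< x<y _ _ = contradiction q (<⇒≢ (zigzag-mono-< p x<y))
  ... | tri≈ _ x≡y _ = x≡y
  ... | tri> _ _ x>y = contradiction q (>⇒≢ (zigzag-mono-< (sym p) x>y))

  -- The first half of the cycle realises the sums `step x`, the second half `P + step x`, for
  -- `x < R`. The hypotheses say that the steps fill the window below `P`, that the pattern of
  -- multiples of `s` recurs in `[P, 2P)`, and that no sum in `[2P, S)` is called for. Asking for
  -- this instead of `s ∣ P` admits `P < s`.
  module TwoHalves {R-1 P s S r : ℕ}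
    (even : parity (suc R-1) ≡ 0ℙ) (r≡R+R : r ≡ suc R-1 + suc R-1)
    (step<P : ∀ {x} → x < suc R-1 → step x < P)
    (s∤1+step : ∀ {x} → x < suc R-1 → ¬ s ∣ suc (step x))
    (step-surjective : ∀ {γ} → γ < P → ¬ s ∣ suc γ → ∃[ x ] (x < suc R-1 × step x ≡ γ))
    (∣-unshift : ∀ {γ} → γ < P → s ∣ suc (P + γ) → s ∣ suc γ)
    (∣-shift : ∀ {γ} → γ < P → s ∣ suc γ → s ∣ suc (P + γ))
    (P+P≤S : P + P ≤ S)
    (<P+P : ∀ {γ} → γ < S → ¬ s ∣ suc γ → γ < P + P)
    where

    R : ℕ
    R = suc R-1

    -- The second half is raised by `A` on one side and by `B` on the other. `A = zigzag R` lets
    -- vertex `R` continue the first zigzag, and `B` is chosen so that each sum moves by `P`.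
    A B : ℕ
    A = zigzag R
    B = P ∸ A

    last-step : zigzag R-1 + A < P
    last-step = step<P (n<1+n R-1)

    A+B≡P : A + B ≡ P
    A+B≡P = m+[n∸m]≡n (≤-trans (m≤n+m A (zigzag R-1)) (<⇒≤ last-step))

    zigzag-R-1<B : zigzag R-1 < B
    zigzag-R-1<B = +-cancelˡ-< A _ _ (subst₂ _<_ (+-comm _ A) (sym A+B≡P) last-step)

    lift : Parity → ℕ
    lift 0ℙ = A
    lift 1ℙ = B

    lifts : ∀ p → lift p + lift (p ⁻¹) ≡ P
    lifts 0ℙ = A+B≡P
    lifts 1ℙ = trans (+-comm B A) A+B≡P

    odd : parity R-1 ≡ 1ℙ
    odd = trans (sym (suc-homo-⁻¹ R-1)) (cong _⁻¹ even)

    -- This separates the halves on each side: even positions are compared with `R`, odd ones with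
    -- `R-1`, whose value is below `B` because the last step is below `P`.
    zigzag<lift : ∀ {x} → x < R → zigzag x < lift (parity x)
    zigzag<lift {x} x<R with parity x in eq
    ... | 0ℙ = zigzag-mono-< (trans eq (sym even)) x<R
    ... | 1ℙ with m≤n⇒m<n∨m≡n (s≤s⁻¹ x<R)
    ...   | inj₂ refl = zigzag-R-1<B
    ...   | inj₁ x<R-1 = <-trans (zigzag-mono-< (trans eq (sym odd)) x<R-1) zigzag-R-1<B
    -- Position `y` of the second half uses `zigzag (suc y)`, so its inner edges give
    -- `P + step (suc y)` and leave `P + step 0` to the closing edge.
    h : ℕ → ℕ
    h x with x <? R
    ... | yes _ = zigzag x
    ... | no  _ = lift (parity (x ∸ R)) + zigzag (suc (x ∸ R))

    h-first : ∀ {x} → x < R → h x ≡ zigzag x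
    h-first {x} x<R with x <? R
    ... | yes _   = refl
    ... | no  x≮R = contradiction x<R x≮R

    h-second : ∀ y → h (R + y) ≡ lift (parity y) + zigzag (suc y)
    h-second y with R + y <? R
    ... | yes p = contradiction p (m+n≮m R y)
    ... | no  _ = cong (λ y → lift (parity y) + zigzag (suc y)) (m+n∸m≡n R y)

    parity-R+ : ∀ y → parity (R + y) ≡ parity y
    parity-R+ y = trans (+-homo-+ R y) (cong (ℙ._+ parity y) even)

    data Half : ℕ → Set where
      first  : ∀ {x} → x < R → Half x
      second : ∀ y → Half (R + y)

    half : ∀ x → Half x
    half x with <-≤-connex x R
    ... | inj₁ x<R = first x<R
    ... | inj₂ R≤x = subst Half (m+[n∸m]≡n R≤x) (second (x ∸ R))

    h-separated : ∀ {x} y → x < R → parity x ≡ parity (R + y) → h x ≢ h (R + y)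
    h-separated {x} y x<R p = <⇒≢ (subst₂ _<_ (sym (h-first x<R)) (sym (h-second y))
      (<-≤-trans (subst (λ p → zigzag x < lift p) (trans p (parity-R+ y)) (zigzag<lift x<R)) (m≤m+n _ _)))

    h-injective : ∀ {x y} → parity x ≡ parity y → h x ≡ h y → x ≡ y
    h-injective {x} {y} p q with half x | half y
    ... | first x<R | first y<R = zigzag-injective p (trans (sym (h-first x<R)) (trans q (h-first y<R)))
    ... | first x<R | second y  = contradiction q (h-separated y x<R p)
    ... | second x  | first y<R = contradiction (sym q) (h-separated x y<R (sym p))
    ... | second x  | second y  = cong (R +_) (suc-injective (zigzag-injective
            (trans (parity-suc x) (trans (cong _⁻¹ px≡py) (sym (parity-suc y))))
            (+-cancelˡ-≡ (lift (parity x)) _ _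
              (trans (sym (h-second x)) (trans q (trans (h-second y)
                (cong (λ p → lift p + zigzag (suc y)) (sym px≡py))))))))
      where
      px≡py : parity x ≡ parity y
      px≡py = trans (sym (parity-R+ x)) (trans p (parity-R+ y))

    -- The cyclic predecessor: `P + step y` is the sum on the edge leaving `R + pred-R y`, and
    -- `y = 0` belongs to the last vertex.
    pred-R : ℕ → ℕ
    pred-R zero    = R-1
    pred-R (suc y) = y

    pred-R<R : ∀ {y} → y < R → pred-R y < R
    pred-R<R {zero}  _   = n<1+n R-1
    pred-R<R {suc y} y<R = <-trans (n<1+n y) y<R

    height′ : Fin r → ℕ
    height′ x = h (toℕ x)

    sum′ : Fin r → ℕ
    sum′ x = height′ x + height′ (next x)

    sum′-first : ∀ {x} → toℕ x < R → sum′ x ≡ step (toℕ x)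
    sum′-first {x} x<R = cong₂ _+_ (h-first x<R) (trans (cong h (toℕ-next-< x 1+x<r)) h-next)
      where
      1+x<r : suc (toℕ x) < r
      1+x<r = subst (suc (toℕ x) <_) (sym r≡R+R) (s≤s (≤-trans x<R (m≤n+m R R-1)))
      h-next : h (suc (toℕ x)) ≡ zigzag (suc (toℕ x))
      h-next with m≤n⇒m<n∨m≡n x<R
      ... | inj₁ 1+x<R = h-first 1+x<R
      -- At the seam the second formula applies; it agrees with the first since `zigzag 1` is `0`
      -- and `A` is `zigzag R`.
      ... | inj₂ 1+x≡R = begin
        h (suc (toℕ x))  ≡⟨ cong h (trans 1+x≡R (sym (+-identityʳ R))) ⟩
        h (R + 0)        ≡⟨ h-second 0 ⟩
        A + zigzag 1     ≡⟨ cong (A +_) zigzag-1 ⟩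
        A + 0            ≡⟨ +-identityʳ A ⟩
        A                ≡⟨ cong zigzag (sym 1+x≡R) ⟩
        zigzag (suc (toℕ x)) ∎
        where open ≡-Reasoning

    sum′-second : ∀ {x y} → y < R → toℕ x ≡ R + pred-R y → sum′ x ≡ P + step y
    -- The closing edge: the last vertex has odd position `R-1`, hence height `B + zigzag R = P`,
    -- and vertex `0` has height `0`.
    sum′-second {x} {zero} _ p = begin
      h (toℕ x) + h (toℕ (next x))                  ≡⟨ cong₂ (λ a b → h a + h b) p next≡0 ⟩
      h (R + R-1) + h 0                             ≡⟨ cong₂ _+_ (h-second R-1) (h-first z<s) ⟩
      lift (parity R-1) + A + zigzag 0              ≡⟨ cong₂ (λ q z → lift q + A + z) odd zigzag-0 ⟩
      B + A + 0                                     ≡⟨ cong₂ _+_ (trans (+-comm B A) A+B≡P)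
                                                         (sym (cong₂ _+_ zigzag-0 zigzag-1)) ⟩
      P + step 0                                    ∎
      where
      open ≡-Reasoning
      next≡0 : toℕ (next x) ≡ 0
      next≡0 = toℕ-next-≡ x (trans (cong suc p) (trans (sym (+-suc R R-1)) (sym r≡R+R)))
    sum′-second {x} {suc y} 1+y<R p = begin
      h (toℕ x) + h (toℕ (next x))
        ≡⟨ cong₂ (λ a b → h a + h b) p (trans (toℕ-next-< x 1+x<r) 1+x≡) ⟩
      h (R + y) + h (R + suc y)
        ≡⟨ cong₂ _+_ (h-second y) (trans (h-second (suc y))
             (cong (λ q → lift q + zigzag (2 + y)) (parity-suc y))) ⟩
      lift (parity y) + zigzag (suc y) + (lift (parity y ⁻¹) + zigzag (2 + y))
        ≡⟨ interchange (lift (parity y)) _ _ _ ⟩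
      lift (parity y) + lift (parity y ⁻¹) + step (suc y)
        ≡⟨ cong (_+ step (suc y)) (lifts (parity y)) ⟩
      P + step (suc y) ∎
      where
      open ≡-Reasoning
      1+x≡ : suc (toℕ x) ≡ R + suc y
      1+x≡ = trans (cong suc p) (sym (+-suc R y))
      1+x<r : suc (toℕ x) < r
      1+x<r = subst₂ _<_ (sym 1+x≡) (sym r≡R+R) (+-monoʳ-< R 1+y<R)

    data SumView (x : Fin r) : Set where
      low  : toℕ x < R → sum′ x ≡ step (toℕ x) → SumView x
      high : ∀ {y} → y < R → toℕ x ≡ R + pred-R y → sum′ x ≡ P + step y → SumView x

    sumView : ∀ x → SumView x
    sumView x with <-≤-connex (toℕ x) R
    ... | inj₁ x<R = low x<R (sum′-first x<R)
    ... | inj₂ R≤x with m≤n⇒m<n∨m≡n z<R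
      where
      z<R : toℕ x ∸ R < R
      z<R = subst (toℕ x ∸ R <_) (m+n∸n≡m R R) (∸-monoˡ-< (subst (toℕ x <_) r≡R+R (toℕ<n x)) R≤x)
    ...   | inj₁ 1+z<R = high 1+z<R (sym (m+[n∸m]≡n R≤x)) (sum′-second 1+z<R (sym (m+[n∸m]≡n R≤x)))
    ...   | inj₂ 1+z≡R = high z<s eq (sum′-second z<s eq)
      where
      eq : toℕ x ≡ R + R-1
      eq = trans (sym (m+[n∸m]≡n R≤x)) (cong (R +_) (suc-injective 1+z≡R))

    sum′<S : ∀ x → sum′ x < S
    sum′<S x with sumView x
    ... | low x<R p = subst (_< S) (sym p) (<-≤-trans (step<P x<R) (≤-trans (m≤m+n P P) P+P≤S))
    ... | high y<R _ p = subst (_< S) (sym p) (<-≤-trans (+-monoʳ-< P (step<P y<R)) P+P≤S)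

    s∤1+sum′ : ∀ x → ¬ s ∣ suc (sum′ x)
    s∤1+sum′ x with sumView x
    ... | low x<R p = s∤1+step x<R ∘ subst (λ γ → s ∣ suc γ) p
    ... | high y<R _ p = s∤1+step y<R ∘ ∣-unshift (step<P y<R) ∘ subst (λ γ → s ∣ suc γ) p

    sum′-injective : ∀ {x y} → sum′ x ≡ sum′ y → x ≡ y
    sum′-injective {x} {y} eq with sumView x | sumView y
    ... | low _ p | low _ q = toℕ-injective (step-injective (trans (sym p) (trans eq q)))
    ... | low x<R p | high y<R _ q =
            contradiction (trans (sym p) (trans eq q)) (<⇒≢ (<-≤-trans (step<P x<R) (m≤m+n P _)))
    ... | high x<R _ p | low y<R q =
            contradiction (trans (sym q) (trans (sym eq) p)) (<⇒≢ (<-≤-trans (step<P y<R) (m≤m+n P _)))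
    ... | high {a} _ x≡ p | high {b} _ y≡ q =
            toℕ-injective (trans x≡ (trans (cong (λ z → R + pred-R z)
              (step-injective {a} {b} (+-cancelˡ-≡ P _ _ (trans (sym p) (trans eq q))))) (sym y≡)))

    sum′-attains-low : ∀ {x} → x < R → ∃[ z ] sum′ z ≡ step x
    sum′-attains-low {x} x<R = fromℕ< x<r ,
        trans (sum′-first (subst (_< R) (sym (toℕ-fromℕ< x<r)) x<R)) (cong step (toℕ-fromℕ< x<r))
      where
      x<r : x < r
      x<r = subst (x <_) (sym r≡R+R) (<-≤-trans x<R (m≤m+n R R))

    sum′-attains-high : ∀ {y} → y < R → ∃[ z ] sum′ z ≡ P + step y
    sum′-attains-high {y} y<R = fromℕ< x<r , sum′-second y<R (toℕ-fromℕ< x<r)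
      where
      x<r : R + pred-R y < r
      x<r = subst (R + pred-R y <_) (sym r≡R+R) (+-monoʳ-< R (pred-R<R y<R))

    sum′-surjective : ∀ {γ} → γ < S → ¬ s ∣ suc γ → ∃[ x ] sum′ x ≡ γ
    sum′-surjective {γ} γ<S s∤ with <-≤-connex γ P
    ... | inj₁ γ<P =
      let x , x<R , p = step-surjective γ<P s∤
          z , q       = sum′-attains-low x<R
      in z , trans q p
    ... | inj₂ P≤γ =
      let y , y<R , p = step-surjective γ∸P<P
                          (s∤ ∘ subst (λ γ → s ∣ suc γ) (m+[n∸m]≡n P≤γ) ∘ ∣-shift γ∸P<P)
          z , q       = sum′-attains-high y<R
      in z , trans q (trans (cong (P +_) p) (m+[n∸m]≡n P≤γ))
      where
      γ∸P<P : γ ∸ P < P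
      γ∸P<P = subst (γ ∸ P <_) (m+n∸n≡m P P) (∸-monoˡ-< (<P+P γ<S s∤) P≤γ)

    r-even : parity r ≡ 0ℙ
    r-even = trans (cong parity r≡R+R) (trans (parity-R+ R) even)

    alternating : ∀ (x : Fin r) → parity (toℕ (next x)) ≡ parity (toℕ x) ⁻¹
    alternating x with m≤n⇒m<n∨m≡n (toℕ<n x)
    ... | inj₁ 1+x<r = trans (cong parity (toℕ-next-< x 1+x<r)) (parity-suc (toℕ x))
    ... | inj₂ 1+x≡r = trans (cong parity (toℕ-next-≡ x 1+x≡r))
                         (trans (sym (trans (cong parity 1+x≡r) r-even)) (parity-suc (toℕ x)))

    cycleLabelling : CycleLabelling r s S
    cycleLabelling = record
      { side             = parity ∘ toℕ
      ; height           = height′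
      ; alternating      = alternating
      ; height-injective = λ p q → toℕ-injective (h-injective p q)
      ; sum<S            = sum′<S
      ; s∤1+sum          = s∤1+sum′
      ; sum-surjective   = sum′-surjective
      ; sum-injective    = sum′-injective
      }

-- The parameters for `s = 4k + 1`, `2k + 1` and `k + 1`

even-double : ∀ k → parity (k + k) ≡ 0ℙ
even-double zero    = refl
even-double (suc k) = trans (cong (parity ∘ suc) (+-suc k k)) (even-double k)

∣1+d+a⇒∣1+a : ∀ {s d a} → s ∣ d → s ∣ suc (d + a) → s ∣ suc a
∣1+d+a⇒∣1+a {s} {d} {a} s∣d p = ∣m+n∣m⇒∣n (subst (s ∣_) (sym (+-suc d a)) p) s∣d

∣1+a⇒∣1+d+a : ∀ {s d a} → s ∣ d → s ∣ suc a → s ∣ suc (d + a)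
∣1+a⇒∣1+d+a {s} {d} {a} s∣d p = subst (s ∣_) (+-suc d a) (∣m∣n⇒∣m+n s∣d p)

4k≡ : ∀ k → 4 * k ≡ k + k + (k + k)
4k≡ = solve-∀

module _ (k-1 : ℕ) where

  private
    k R : ℕ
    k = suc k-1
    R = k + k

  -- With `P = R` the sums are all numbers below `2R = s - 1`, and the only multiple of `s` among
  -- `1`, ..., `s` is `s` itself. The zigzag is evaluated only up to `R`, where a gap at `R` leaves
  -- it uncorrected.
  cycleLabelling₁ : CycleLabelling (4 * k) (4 * k + 1) (4 * k + 1)
  cycleLabelling₁ = subst (λ s → CycleLabelling (4 * k) s s)
    (trans (cong suc (sym (4k≡ k))) (+-comm 1 (4 * k))) labelling
    where
    open ZigZag R z<s
    s = suc (R + R)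
    s∤ : ∀ {γ} → γ < R + R → ¬ s ∣ suc γ
    s∤ γ<R+R = >⇒∤ (s<s γ<R+R)
    labelling : CycleLabelling (4 * k) s s
    labelling = TwoHalves.cycleLabelling {P = R} (even-double k) (4k≡ k)
      (λ x<R → subst (_< R) (sym (step-below x<R)) x<R)
      (λ x<R → subst (λ γ → ¬ s ∣ suc γ) (sym (step-below x<R)) (s∤ (<-≤-trans x<R (m≤m+n R R))))
      (λ {γ} γ<R _ → γ , γ<R , step-below γ<R)
      (λ γ<R p → contradiction p (s∤ (+-monoʳ-< R γ<R)))
      (λ γ<R p → contradiction p (s∤ (<-≤-trans γ<R (m≤m+n R R))))
      (n≤1+n (R + R))
      (λ γ<s s∤1+γ → ≤∧≢⇒< (s≤s⁻¹ γ<s) λ { refl → s∤1+γ ∣-refl })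

  -- With `P = s = R + 1` the steps `0`, ..., `R - 1` miss only `R`, whose successor is `s`.
  cycleLabelling₂ : CycleLabelling (4 * k) (2 * k + 1) (2 * (2 * k + 1))
  cycleLabelling₂ = subst (λ s → CycleLabelling (4 * k) s (2 * s)) (s≡ k) labelling
    where
    open ZigZag R z<s
    s = suc R
    s≡ : ∀ k → suc (k + k) ≡ 2 * k + 1
    s≡ = solve-∀
    labelling : CycleLabelling (4 * k) s (2 * s)
    labelling = TwoHalves.cycleLabelling {P = s} (even-double k) (4k≡ k)
      (λ x<R → subst (_< s) (sym (step-below x<R)) (m<n⇒m<1+n x<R))
      (λ x<R → subst (λ γ → ¬ s ∣ suc γ) (sym (step-below x<R)) (>⇒∤ (s<s x<R)))
      (λ {γ} γ<s s∤1+γ → let γ<R = ≤∧≢⇒< (s≤s⁻¹ γ<s) (λ { refl → s∤1+γ ∣-refl }) in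
         γ , γ<R , step-below γ<R)
      (λ _ → ∣1+d+a⇒∣1+a ∣-refl)
      (λ _ → ∣1+a⇒∣1+d+a ∣-refl)
      (≤-reflexive (cong (s +_) (sym (+-identityʳ s))))
      (λ {γ} γ<2s _ → subst (γ <_) (cong (s +_) (+-identityʳ s)) γ<2s)

  -- With `P = 2s = 2k + 2` and the gap at `k`, the steps are `0`, ..., `k - 1` and `k + 1`, ...,
  -- `2k`. The missing values `k` and `2k + 1` precede the multiples `s` and `2s`.
  cycleLabelling₄ : CycleLabelling (4 * k) (k + 1) (4 * (k + 1))
  cycleLabelling₄ = subst (λ s → CycleLabelling (4 * k) s (4 * s)) (+-comm 1 k) labelling
    where
    open ZigZag k z<s
    s = suc k
    P = s + s
    s∣P : s ∣ P
    s∣P = ∣m∣n⇒∣m+n ∣-refl ∣-refl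

    s∤1+step : ∀ {x} → x < R → ¬ s ∣ suc (step x)
    s∤1+step {x} x<R with <-≤-connex x k
    ... | inj₁ x<k = subst (λ γ → ¬ s ∣ suc γ) (sym (step-below x<k)) (>⇒∤ (s<s x<k))
    ... | inj₂ k≤x = λ p → >⇒∤ (s<s x∸k<k) (∣m+n∣m⇒∣n (subst (s ∣_) 2+x≡ p) ∣-refl)
      where
      x∸k<k : x ∸ k < k
      x∸k<k = subst (x ∸ k <_) (m+n∸n≡m k k) (∸-monoˡ-< x<R k≤x)
      2+x≡ : suc (step x) ≡ s + suc (x ∸ k)
      2+x≡ = trans (cong suc (step-above k≤x))
               (cong suc (trans (cong suc (sym (m+[n∸m]≡n k≤x))) (sym (+-suc k _))))

    step-surjective : ∀ {γ} → γ < P → ¬ s ∣ suc γ → ∃[ x ] (x < R × step x ≡ γ)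
    step-surjective {γ} γ<P s∤1+γ with <-cmp γ k
    ... | tri< γ<k _ _ = γ , <-≤-trans γ<k (m≤m+n k k) , step-below γ<k
    ... | tri≈ _ refl _ = contradiction ∣-refl s∤1+γ
    step-surjective {suc x} γ<P s∤1+γ | tri> _ _ k<γ = x , x<R , step-above (s≤s⁻¹ k<γ)
      where
      P≡2+R : P ≡ suc (suc R)
      P≡2+R = cong suc (+-suc k k)
      x<R : x < R
      -- The bound on `γ` allows `x = R`, but then `suc γ` would be `P`, a multiple of `s`.
      x<R = ≤∧≢⇒< (s≤s⁻¹ (s≤s⁻¹ (subst (suc x <_) P≡2+R γ<P)))
              λ x≡R → s∤1+γ (subst (s ∣_) (trans P≡2+R (cong (suc ∘ suc) (sym x≡R))) s∣P)

    labelling : CycleLabelling (4 * k) s (4 * s)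
    labelling = TwoHalves.cycleLabelling {P = P} (even-double k) (4k≡ k)
      (λ {x} x<R → ≤-<-trans (step≤ x) (s≤s (≤-trans x<R (+-monoʳ-≤ k (n≤1+n k)))))
      s∤1+step
      step-surjective
      (λ _ → ∣1+d+a⇒∣1+a s∣P)
      (λ _ → ∣1+a⇒∣1+d+a s∣P)
      (≤-reflexive (sym (4k≡ s)))
      (λ {γ} γ<4s _ → subst (γ <_) (4k≡ s) γ<4s)

-- Residue classes as the parts of the multipartite graph

cylinder-adj? : ∀ {r m} (3≤r : 3 ≤ r) → B.Decidable (Adj (cycle r 3≤r □ path m))
cylinder-adj? _ (j , i) (j′ , i′) =
  ((next j Fin.≟ j′ ⊎-dec next j′ Fin.≟ j) ×-dec i Fin.≟ i′) ⊎-dec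
  (j Fin.≟ j′ ×-dec (suc (toℕ i) ≟ toℕ i′ ⊎-dec suc (toℕ i′) ≟ toℕ i))

partOf : ∀ {s} t → Fin (t * s) → Fin s
partOf {s} t i = proj₂ (remQuot {t} s i)

toℕ-partOf : ∀ {s} t .{{_ : NonZero s}} i → toℕ (partOf {s} t i) ≡ toℕ i % s
toℕ-partOf {s} t i = begin
  toℕ ρ                    ≡⟨ m<n⇒m%n≡m (toℕ<n ρ) ⟨
  toℕ ρ % s                ≡⟨ %-remove-+ˡ (toℕ ρ) (m∣m*n (toℕ q)) ⟨
  (s * toℕ q + toℕ ρ) % s  ≡⟨ cong (_% s) (toℕ-combine q ρ) ⟨
  toℕ (combine q ρ) % s    ≡⟨ cong (λ i → toℕ i % s) (Fin.combine-remQuot {t} s i) ⟩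
  toℕ i % s                ∎
  where
  open ≡-Reasoning
  q = proj₁ (remQuot {t} s i)
  ρ = partOf {s} t i

module _ {r s S t : ℕ} (3≤r : 3 ≤ r) (L : CycleLabelling r s S) .{{s≢0 : NonZero s}} .{{S≢0 : NonZero S}}
         (s∣S : s ∣ S) (n m-1 : ℕ) .{{_ : NonZero n}} where

  open Cylinder 3≤r s∣S L n m-1 using (W; H; sumLabelling)

  cylinder-decomposition : t * s ≡ H + H → HasCyclicDecomposition (cycle r 3≤r □ path (suc m-1)) (K s t)
  cylinder-decomposition eq =
    FromLabelling.hasCyclicDecomposition (×-searchable (λ P? → Fin.any? P?) (λ P? → Fin.any? P?))
      (cylinder-adj? 3≤r) (≡-dec Fin._≟_ Fin._≟_) (∣n⇒∣m*n (n * W) s∣S) eq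
      -- The bijection yields quotient and remainder by `s`; swapping them makes the residue modulo
      -- `s` the part of `K s t`.
      (×-comm (Fin t) (Fin s) ↔-∘ Fin.*↔× {t} {s})
      (λ i j → mk⇔
        (λ i≢j p → i≢j (toℕ-injective (trans (toℕ-partOf t i) (trans p (sym (toℕ-partOf t j))))))
        (λ i≢j p → i≢j (trans (sym (toℕ-partOf t i)) (trans (cong toℕ p) (toℕ-partOf t j)))))
      sumLabelling
    where
    instance
      nW≢0 : NonZero (n * W)
      nW≢0 = m*n≢0 n W
      H≢0 : NonZero H
      H≢0 = m*n≢0 (n * W) S
      ts≢0 : NonZero (t * s)
      ts≢0 = >-nonZero (<-≤-trans (>-nonZero⁻¹ H) (≤-trans (m≤m+n H H) (≤-reflexive (sym eq))))

instance
  n+1≢0 : ∀ {n} → NonZero (n + 1)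
  n+1≢0 {n} = >-nonZero (m≤n+m 1 n)

proposition3p6 : (k n m : ℕ) (1≤k : 1 ≤ k) → 1 ≤ n → 2 < m →
    HasCyclicDecomposition (cycle (4 * k) (3≤4*k 1≤k) □ path m) (K (4 * k + 1) (2 * (2 * m ∸ 1) * n)) ×
    HasCyclicDecomposition (cycle (4 * k) (3≤4*k 1≤k) □ path m) (K (2 * k + 1) (4 * (2 * m ∸ 1) * n)) ×
    HasCyclicDecomposition (cycle (4 * k) (3≤4*k 1≤k) □ path m) (K (k + 1) (8 * (2 * m ∸ 1) * n))
proposition3p6 zero _ _ () _ _
proposition3p6 (suc _) _ zero _ _ ()
proposition3p6 k@(suc k-1) n@(suc _) (suc m-1) 1≤k _ _ =
    cylinder-decomposition 3≤4k (cycleLabelling₁ k-1) ∣-refl n m-1 (order₁ m-1 n (4 * k + 1))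
  , cylinder-decomposition 3≤4k (cycleLabelling₂ k-1) {{S≢0 = m*n≢0 2 (2 * k + 1)}}
      (n∣m*n 2) n m-1 (order₂ m-1 n (2 * k + 1))
  , cylinder-decomposition 3≤4k (cycleLabelling₄ k-1) {{S≢0 = m*n≢0 4 (k + 1)}}
      (n∣m*n 4) n m-1 (order₄ m-1 n (k + 1))
  where
  3≤4k = 3≤4*k 1≤k
  -- The identity `t * s = 2H` for `S = s`, with `2s` and `4s` below. The factor `m + suc (m + 0)`
  -- is what `2 * suc m ∸ 1` computes to.
  order₁ : ∀ m n s → 2 * (m + suc (m + 0)) * n * s ≡ n * suc (m + m) * s + n * suc (m + m) * s
  order₁ = solve-∀
  order₂ : ∀ m n s → 4 * (m + suc (m + 0)) * n * s ≡ n * suc (m + m) * (2 * s) + n * suc (m + m) * (2 * s)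
  order₂ = solve-∀
  order₄ : ∀ m n s → 8 * (m + suc (m + 0)) * n * s ≡ n * suc (m + m) * (4 * s) + n * suc (m + m) * (4 * s)
  order₄ = solve-∀
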